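{- Assume that there is a real number $\alpha>0$ such that $$\liminf_{x\to\infty}\frac{\#T_{\leq x}(\alpha)}{x}=0.$$ Then there is no perfect Euler brick. In particular, if there is $\alpha>0$ such that $T(\alpha)$ is finite, then there is no perfect Euler brick.
   Context: A perfect Euler brick is a rectangular cuboid whose edges, face diagonals and space diagonal all have (positive) integral lengths. $\mathbb{N}$ is the set of positive integers; $\lfloor x\rfloor$ is the integer part (floor) of $x$. For $X\subseteq\mathbb{N}$, $T(X)$ is the set of all tuples $(k,\ell,m)\in\mathbb{N}^3$ with $k\leq \ell\leq m$ such that all of $k,\ \ell,\ m,\ k+\ell,\ \ell+m,\ m+k,\ k+\ell+m$ belong to $X$. For $\alpha>0$, let $S(\alpha)=\{\lfloor \alpha n^2\rfloor : n\in\mathbb{N},\ n\geq \alpha^{ -1/2}\}$ and $T(\alpha)=T(S(\alpha))$. For $\alpha>0$ and $x>1$, let $T_{\leq x}(\alpha)=\{(\lfloor \alpha n_1^2\rfloor,\lfloor\alpha n_2^2\rfloor,\lfloor\alpha n_3^2\rfloor)\in T(\alpha) : n_1,n_2,n_3\in[\alpha^{ -1/2},x]\cap\mathbb{N}\}$. -}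

module Defs where

open import Data.Empty using (⊥)
open import Data.Integer as ℤ using ()
open import Data.List using (List; length)
open import Data.List.Membership.Propositional using (_∈_)
open import Data.List.Relation.Unary.Unique.Propositional using (Unique)
open import Data.Nat as ℕ using (ℕ; zero; suc)
open import Data.Product using (Σ-syntax; ∃; ∃-syntax; _×_; _,_)
open import Data.Rational as ℚ using (ℚ; 0ℚ; 1ℚ)
import Data.Rational.Properties as ℚₚ
open import Data.Sum as Sum using (_⊎_; inj₁; inj₂)
open import Function using (_⇔_)
open import Level using (0ℓ)
open import Relation.Binary.Definitions using (tri<; tri≈; tri>)
open import Relation.Binary.PropositionalEquality
  using (_≡_; refl; sym; trans; cong; subst)
open import Relation.Nullary using (¬_; Dec; yes; no; contradiction)
open import Relation.Unary using (Pred)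

fromℕℚ : ℕ → ℚ
fromℕℚ n = ℤ.+ n ℚ./ 1

module RationalLemmas where
  open import Data.Rational using (_+_; _*_; _-_; _<_; _≤_; -_; Positive; positive; nonNegative; 1/_)
  open ℚₚ

  abstract
    p-1<p : ∀ p → p - 1ℚ < p
    p-1<p p = subst (p - 1ℚ <_) (+-identityʳ p) (+-monoʳ-< p (negative⁻¹ (- 1ℚ)))

    p<p+1 : ∀ p → p < p + 1ℚ
    p<p+1 p = subst (_< p + 1ℚ) (+-identityʳ p) (+-monoʳ-< p (positive⁻¹ 1ℚ))

    *-mono-≤ʳ : ∀ {p q r} → 0ℚ ≤ r → p ≤ q → p * r ≤ q * r
    *-mono-≤ʳ {r = r} 0≤r = *-monoʳ-≤-nonNeg r {{nonNegative 0≤r}}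

    *-mono-≤ˡ : ∀ {p q r} → 0ℚ ≤ r → p ≤ q → r * p ≤ r * q
    *-mono-≤ˡ {r = r} 0≤r = *-monoˡ-≤-nonNeg r {{nonNegative 0≤r}}

    *-mono-<ʳ : ∀ {p q r} → 0ℚ < r → p < q → p * r < q * r
    *-mono-<ʳ {r = r} 0<r = *-monoˡ-<-pos r {{positive 0<r}}

    *-mono-<ˡ : ∀ {p q r} → 0ℚ < r → p < q → r * p < r * q
    *-mono-<ˡ {r = r} 0<r = *-monoʳ-<-pos r {{positive 0<r}}

    *-cancel-<ʳ : ∀ {p q r} → 0ℚ ≤ r → p * r < q * r → p < q
    *-cancel-<ʳ {r = r} 0≤r = *-cancelʳ-<-nonNeg r {{nonNegative 0≤r}}

    *-pos : ∀ {p q} → 0ℚ < p → 0ℚ < q → 0ℚ < p * q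
    *-pos {p} {q} 0<p 0<q = subst (_< p * q) (*-zeroˡ q) (*-mono-<ʳ 0<q 0<p)

    quotient : ∀ p {r} → 0ℚ < r → ∃[ s ] s * r ≡ p
    quotient p {r} 0<r =
      p * inv , trans (*-assoc p inv r) (trans (cong (p *_) (*-inverseˡ r {{r≢0}})) (*-identityʳ p))
      where
      r≢0 : ℚ.NonZero r
      r≢0 = pos⇒nonZero r {{positive 0<r}}
      inv : ℚ
      inv = (1/ r) {{r≢0}}

    quotient-< : ∀ {p q r s t} → 0ℚ < r → s * r ≡ p → t * r ≡ q → p < q → s < t
    quotient-< {r = r} {s} {t} 0<r refl refl = *-cancel-<ʳ {s} {t} {r} (<⇒≤ 0<r)

    quotient-pos : ∀ {p r s} → 0ℚ < r → s * r ≡ p → 0ℚ < p → 0ℚ < s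
    quotient-pos {p} {r} {s} 0<r sr≡p 0<p = quotient-< {0ℚ} {p} {r} {0ℚ} {s} 0<r (*-zeroˡ r) sr≡p 0<p

    quotient-anti : ∀ {p q r s t} → 0ℚ < q → q < r → 0ℚ < p → s * r ≡ p → t * q ≡ p → s < t
    quotient-anti {p} {q} {r} {s} {t} 0<q q<r 0<p sr≡p tq≡p = quotient-< {s * q} {p} {q} {s} {t} 0<q refl tq≡p
      (subst (s * q <_) sr≡p (*-mono-<ˡ {q} {r} {s} (quotient-pos {p} {r} {s} (<-trans 0<q q<r) sr≡p 0<p) q<r))

    0≤fromℕℚ : ∀ n → 0ℚ ≤ fromℕℚ n
    0≤fromℕℚ n = nonNegative⁻¹ (fromℕℚ n) {{normalize-nonNeg n 1}}

    0<fromℕℚ-suc : ∀ n → 0ℚ < fromℕℚ (suc n)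
    0<fromℕℚ-suc n = positive⁻¹ (fromℕℚ (suc n)) {{normalize-pos (suc n) 1}}

open RationalLemmas

-- A real number is a two-sided Dedekind cut: L is {q | q < x}, U is {q | x < q}.

record ℝ : Set₁ where
  field
    L U      : ℚ → Set
    L-inhab  : ∃ L
    U-inhab  : ∃ U
    L-lower  : ∀ {p q} → p ℚ.< q → L q → L p
    U-upper  : ∀ {p q} → p ℚ.< q → U p → U q
    L-open   : ∀ {p} → L p → ∃[ q ] p ℚ.< q × L q
    U-open   : ∀ {q} → U q → ∃[ p ] p ℚ.< q × U p
    disjoint : ∀ {q} → L q → U q → ⊥
    located  : ∀ {p q} → p ℚ.< q → L p ⊎ U q

  L<U : ∀ {p q} → L p → U q → p ℚ.< q
  L<U {p} {q} Lp Uq with ℚₚ.<-cmp p q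
  ... | tri< p<q _ _  = p<q
  ... | tri≈ _ refl _ = contradiction Uq (disjoint Lp)
  ... | tri> _ _ q<p  = contradiction Uq (disjoint (L-lower q<p Lp))

open ℝ public using (L; U)

infix 4 _<_ _≤_

_<_ : ℝ → ℝ → Set
x < y = ∃[ q ] U x q × L y q

_≤_ : ℝ → ℝ → Set
x ≤ y = ¬ (y < x)

fromℚ : ℚ → ℝ
fromℚ r = record
  { L        = ℚ._< r
  ; U        = r ℚ.<_
  ; L-inhab  = r ℚ.- 1ℚ , p-1<p r
  ; U-inhab  = r ℚ.+ 1ℚ , p<p+1 r
  ; L-lower  = ℚₚ.<-trans
  ; U-upper  = λ p<q r<p → ℚₚ.<-trans r<p p<q
  ; L-open   = ℚₚ.<-dense
  ; U-open   = λ r<q → let m , r<m , m<q = ℚₚ.<-dense r<q in m , m<q , r<m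
  ; disjoint = ℚₚ.<-asym
  ; located  = loc
  }
  where
  loc : ∀ {p q} → p ℚ.< q → p ℚ.< r ⊎ r ℚ.< q
  loc {p} p<q with p ℚₚ.<? r
  ... | yes p<r = inj₁ p<r
  ... | no  p≮r = inj₂ (ℚₚ.≤-<-trans (ℚₚ.≮⇒≥ p≮r) p<q)

fromℕ : ℕ → ℝ
fromℕ n = fromℚ (fromℕℚ n)

0ℝ 1ℝ : ℝ
0ℝ = fromℕ 0
1ℝ = fromℕ 1

-- The real sup A = inf B, for sets A of lower bounds and B of upper bounds
-- that leave no gap.

cut : (A B : ℚ → Set) → ∃ A → ∃ B →
      (∀ {r s} → A r → B s → r ℚ.≤ s) →
      (∀ {a b} → a ℚ.< b → A a ⊎ B b) → ℝ
cut A B (a , Aa) (b , Bb) A≤B gapless = record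
  { L        = λ q → ∃[ r ] q ℚ.< r × A r
  ; U        = λ q → ∃[ s ] s ℚ.< q × B s
  ; L-inhab  = a ℚ.- 1ℚ , a , p-1<p a , Aa
  ; U-inhab  = b ℚ.+ 1ℚ , b , p<p+1 b , Bb
  ; L-lower  = λ { p<q (r , q<r , Ar) → r , ℚₚ.<-trans p<q q<r , Ar }
  ; U-upper  = λ { p<q (s , s<p , Bs) → s , ℚₚ.<-trans s<p p<q , Bs }
  ; L-open   = λ { (r , q<r , Ar) →
                 let m , q<m , m<r = ℚₚ.<-dense q<r in m , q<m , r , m<r , Ar }
  ; U-open   = λ { (s , s<q , Bs) →
                 let m , s<m , m<q = ℚₚ.<-dense s<q in m , m<q , s , s<m , Bs }
  ; disjoint = λ { (r , q<r , Ar) (s , s<q , Bs) →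
                 ℚₚ.<-irrefl refl (ℚₚ.<-≤-trans (ℚₚ.<-trans s<q q<r) (A≤B Ar Bs)) }
  ; located  = loc
  }
  where
  loc : ∀ {p q} → p ℚ.< q → (∃[ r ] p ℚ.< r × A r) ⊎ (∃[ s ] s ℚ.< q × B s)
  loc p<q with ℚₚ.<-dense p<q
  ... | c , p<c , c<q with ℚₚ.<-dense c<q
  ... | d , c<d , d<q with gapless c<d
  ... | inj₁ Ac = inj₁ (c , p<c , Ac)
  ... | inj₂ Bd = inj₂ (d , d<q , Bd)

infixl 7 _·_ _/_[_]

_·_ : ℕ → ℝ → ℝ
n · x = cut A B
  (let l , Ll = ℝ.L-inhab x in l ℚ.* n′ , l , Ll , ℚₚ.≤-refl)
  (let u , Uu = ℝ.U-inhab x in u ℚ.* n′ , u , Uu , ℚₚ.≤-refl)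
  (λ { (l , Ll , r≤ln) (u , Uu , un≤s) →
     ℚₚ.≤-trans r≤ln (ℚₚ.≤-trans
       (*-mono-≤ʳ (0≤fromℕℚ n) (ℚₚ.<⇒≤ (ℝ.L<U x Ll Uu))) un≤s) })
  (gapless n)
  module Scale where
  n′ : ℚ
  n′ = fromℕℚ n

  A B : ℚ → Set
  A r = ∃[ l ] L x l × r ℚ.≤ l ℚ.* n′
  B s = ∃[ u ] U x u × u ℚ.* n′ ℚ.≤ s

  gapless : ∀ m {a b} → a ℚ.< b →
            (∃[ l ] L x l × a ℚ.≤ l ℚ.* fromℕℚ m) ⊎ (∃[ u ] U x u × u ℚ.* fromℕℚ m ℚ.≤ b)
  gapless zero {a} {b} a<b with a ℚₚ.≤? 0ℚ
  ... | yes a≤0 = let l , Ll = ℝ.L-inhab x in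
                  inj₁ (l , Ll , subst (a ℚ.≤_) (sym (ℚₚ.*-zeroʳ l)) a≤0)
  ... | no  a≰0 = let u , Uu = ℝ.U-inhab x in
                  inj₂ (u , Uu , subst (ℚ._≤ b) (sym (ℚₚ.*-zeroʳ u))
                                   (ℚₚ.<⇒≤ (ℚₚ.<-trans (ℚₚ.≰⇒> a≰0) a<b)))
  gapless (suc m) {a} {b} a<b =
    let 0<m+1    = 0<fromℕℚ-suc m
        c , cm≡a = quotient a 0<m+1
        d , dm≡b = quotient b 0<m+1
    in Sum.map (λ Lc → c , Lc , ℚₚ.≤-reflexive (sym cm≡a))
               (λ Ud → d , Ud , ℚₚ.≤-reflexive dm≡b)
               (ℝ.located x (quotient-< {s = c} {d} 0<m+1 cm≡a dm≡b a<b))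

-- c / x as a cut: r ≤ c / x when r u ≤ c for some u > x, and c / x ≤ s when
-- c ≤ s l for some 0 < l < x.

_/_[_] : ℕ → (x : ℝ) → 0ℝ < x → ℝ
c / x [ q₀ , 0<q₀ , Lq₀ ] = cut A B
  (let u , Uu = ℝ.U-inhab x in
   0ℚ , u , Uu , subst (ℚ._≤ c′) (sym (ℚₚ.*-zeroˡ u)) (0≤fromℕℚ c))
  (let s , sq₀≡c = quotient c′ 0<q₀ in
   s , q₀ , Lq₀ , 0<q₀ , ℚₚ.≤-reflexive (sym sq₀≡c))
  A≤B gapless
  module Quotient where
  c′ : ℚ
  c′ = fromℕℚ c

  A B : ℚ → Set
  A r = ∃[ u ] U x u × r ℚ.* u ℚ.≤ c′
  B s = ∃[ l ] L x l × 0ℚ ℚ.< l × c′ ℚ.≤ s ℚ.* l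

  A≤B : ∀ {r s} → A r → B s → r ℚ.≤ s
  A≤B {r} {s} (u , Uu , ru≤c) (l , Ll , 0<l , c≤sl) = ℚₚ.≮⇒≥ λ s<r →
    let 0≤s = ℚₚ.≮⇒≥ λ s<0 → ℚₚ.<-irrefl refl (ℚₚ.≤-<-trans (0≤fromℕℚ c)
                (ℚₚ.≤-<-trans c≤sl (subst (s ℚ.* l ℚ.<_) (ℚₚ.*-zeroˡ l) (*-mono-<ʳ 0<l s<0))))
        0<r = ℚₚ.≤-<-trans 0≤s s<r
        sl<ru = ℚₚ.<-trans (*-mono-<ʳ 0<l s<r) (*-mono-<ˡ 0<r (ℝ.L<U x Ll Uu))
    in ℚₚ.<-irrefl refl (ℚₚ.<-≤-trans sl<ru (ℚₚ.≤-trans ru≤c c≤sl))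

  gapless : ∀ {a b} → a ℚ.< b → A a ⊎ B b
  gapless {a} {b} a<b = case (a ℚₚ.≤? 0ℚ) (0ℚ ℚₚ.<? c′)
    where
    case : Dec (a ℚ.≤ 0ℚ) → Dec (0ℚ ℚ.< c′) → A a ⊎ B b
    case (yes a≤0) _ =
      let u , Uu = ℝ.U-inhab x
          0≤u    = ℚₚ.<⇒≤ (ℚₚ.<-trans 0<q₀ (ℝ.L<U x Lq₀ Uu))
      in inj₁ (u , Uu , ℚₚ.≤-trans (subst (a ℚ.* u ℚ.≤_) (ℚₚ.*-zeroˡ u) (*-mono-≤ʳ 0≤u a≤0))
                          (0≤fromℕℚ c))
    case (no a≰0) (no 0≮c) =
      inj₂ (q₀ , Lq₀ , 0<q₀ , ℚₚ.≤-trans (ℚₚ.≮⇒≥ 0≮c)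
        (ℚₚ.<⇒≤ (*-pos (ℚₚ.<-trans (ℚₚ.≰⇒> a≰0) a<b) 0<q₀)))
    case (no a≰0) (yes 0<c) =
      let 0<a       = ℚₚ.≰⇒> a≰0
          0<b       = ℚₚ.<-trans 0<a a<b
          d , da≡c  = quotient c′ 0<a
          e , eb≡c  = quotient c′ 0<b
      in Sum.map (λ Ud → d , Ud , ℚₚ.≤-reflexive (trans (ℚₚ.*-comm a d) da≡c))
                 (λ Le → e , Le , quotient-pos {s = e} 0<b eb≡c 0<c
                       , ℚₚ.≤-reflexive (trans (sym eb≡c) (ℚₚ.*-comm e b)))
                 (Sum.swap (ℝ.located x (quotient-anti {s = e} {d} 0<a a<b 0<c eb≡c da≡c)))

-- α^(-1/2) as a cut: a positive rational r is below it when r² u ≤ 1 for some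
-- u > α, and above it when 1 ≤ r² l for some l < α.

_^-½[_] : (α : ℝ) → 0ℝ < α → ℝ
α ^-½[ q₀ , 0<q₀ , Lq₀ ] = cut A B (0ℚ , inj₁ ℚₚ.≤-refl) B-inhab A≤B gapless
  module InvSqrt where
  A B : ℚ → Set
  A r = r ℚ.≤ 0ℚ ⊎ (∃[ u ] U α u × r ℚ.* r ℚ.* u ℚ.≤ 1ℚ)
  B s = 0ℚ ℚ.< s × (∃[ l ] L α l × 1ℚ ℚ.≤ s ℚ.* s ℚ.* l)

  B-inhab : ∃ B
  B-inhab with quotient 1ℚ 0<q₀
  ... | t , tq₀≡1 = s , 0<s , q₀ , Lq₀ , 1≤ssq₀
    where
    0<t : 0ℚ ℚ.< t
    0<t = quotient-pos {s = t} 0<q₀ tq₀≡1 (ℚₚ.positive⁻¹ 1ℚ)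

    s : ℚ
    s = t ℚ.+ 1ℚ

    0<s : 0ℚ ℚ.< s
    0<s = ℚₚ.<-trans 0<t (p<p+1 t)

    1≤s : 1ℚ ℚ.≤ s
    1≤s = subst (ℚ._≤ s) (ℚₚ.+-identityˡ 1ℚ) (ℚₚ.+-monoˡ-≤ 1ℚ (ℚₚ.<⇒≤ 0<t))

    1≤sq₀ : 1ℚ ℚ.≤ s ℚ.* q₀
    1≤sq₀ = subst (ℚ._≤ s ℚ.* q₀) tq₀≡1 (*-mono-≤ʳ (ℚₚ.<⇒≤ 0<q₀) (ℚₚ.<⇒≤ (p<p+1 t)))

    1≤ssq₀ : 1ℚ ℚ.≤ s ℚ.* s ℚ.* q₀
    1≤ssq₀ = subst (1ℚ ℚ.≤_) (sym (ℚₚ.*-assoc s s q₀))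
      (ℚₚ.≤-trans 1≤s
        (subst (ℚ._≤ s ℚ.* (s ℚ.* q₀)) (ℚₚ.*-identityʳ s) (*-mono-≤ˡ (ℚₚ.<⇒≤ 0<s) 1≤sq₀)))

  square-< : ∀ {p q} → 0ℚ ℚ.< p → p ℚ.< q → p ℚ.* p ℚ.< q ℚ.* q
  square-< 0<p p<q =
    ℚₚ.<-trans (*-mono-<ˡ 0<p p<q) (*-mono-<ʳ (ℚₚ.<-trans 0<p p<q) p<q)

  A≤B : ∀ {r s} → A r → B s → r ℚ.≤ s
  A≤B (inj₁ r≤0) (0<s , _) = ℚₚ.<⇒≤ (ℚₚ.≤-<-trans r≤0 0<s)
  A≤B {r} {s} (inj₂ (u , Uu , rru≤1)) (0<s , l , Ll , 1≤ssl) = ℚₚ.≮⇒≥ λ s<r →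
    let 0<u     = ℚₚ.<-trans 0<q₀ (ℝ.L<U α Lq₀ Uu)
        ssl<ssu = *-mono-<ˡ (*-pos 0<s 0<s) (ℝ.L<U α Ll Uu)
        ssu<rru = *-mono-<ʳ 0<u (square-< 0<s s<r)
    in ℚₚ.<-irrefl refl (ℚₚ.<-≤-trans (ℚₚ.<-trans ssl<ssu ssu<rru) (ℚₚ.≤-trans rru≤1 1≤ssl))

  gapless : ∀ {a b} → a ℚ.< b → A a ⊎ B b
  gapless {a} {b} a<b = case (a ℚₚ.≤? 0ℚ)
    where
    case : Dec (a ℚ.≤ 0ℚ) → A a ⊎ B b
    case (yes a≤0) = inj₁ (inj₁ a≤0)
    case (no  a≰0) =
      let 0<a        = ℚₚ.≰⇒> a≰0
          0<b        = ℚₚ.<-trans 0<a a<b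
          d , daa≡1  = quotient 1ℚ (*-pos 0<a 0<a)
          e , ebb≡1  = quotient 1ℚ (*-pos 0<b 0<b)
          e<d        = quotient-anti {s = e} {d} (*-pos 0<a 0<a) (square-< 0<a a<b)
                         (ℚₚ.positive⁻¹ 1ℚ) ebb≡1 daa≡1
      in Sum.map (λ Ud → inj₂ (d , Ud , ℚₚ.≤-reflexive (trans (ℚₚ.*-comm (a ℚ.* a) d) daa≡1)))
                 (λ Le → 0<b , e , Le , ℚₚ.≤-reflexive (trans (sym ebb≡1) (ℚₚ.*-comm e (b ℚ.* b))))
                 (Sum.swap (ℝ.located α e<d))

-- Constructively the floor of a real is a relation, not a function.

⌊_⌋≡_ : ℝ → ℕ → Set
⌊ x ⌋≡ k = fromℕ k ≤ x × x < fromℕ (suc k)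

-- A function on the reals is given by its graph: F x y means that it is
-- defined at x with value y. "¬ ¬ ∃" is the classical existential quantifier,
-- so that assuming a liminf supplies no constructive witnesses.

LiminfAt∞ : (ℝ → ℝ → Set₁) → ℝ → Set₁
LiminfAt∞ F ℓ =
    (∀ a → a < ℓ → ¬ ¬ (∃[ X ] ∀ x y → X ≤ x → F x y → a < y))
  × (∀ b → ℓ < b → ∀ X → ¬ ¬ (∃[ x ] ∃[ y ] X ≤ x × F x y × y < b))

HasCardinality : {A : Set} → Pred A 0ℓ → ℕ → Set
HasCardinality P c =
  ∃[ xs ] Unique xs × (∀ t → t ∈ xs ⇔ P t) × length xs ≡ c

-- Membership need not be decidable, so a finite set is one whose elements
-- all occur in some list.

Finite : {A : Set} → Pred A 0ℓ → Set
Finite {A} P = Σ[ xs ∈ List A ] (∀ t → P t → t ∈ xs)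

-- A tuple of T X consists of positive integers: k ≥ 1 gives ℓ , m ≥ 1.

record T (X : Pred ℕ 0ℓ) (t : ℕ × ℕ × ℕ) : Set where
  constructor mkT
  k = let k , _ , _ = t in k
  ℓ = let _ , ℓ , _ = t in ℓ
  m = let _ , _ , m = t in m
  field
    k≥1    : 1 ℕ.≤ k
    k≤ℓ    : k ℕ.≤ ℓ
    ℓ≤m    : ℓ ℕ.≤ m
    k∈     : X k
    ℓ∈     : X ℓ
    m∈     : X m
    k+ℓ∈   : X (k ℕ.+ ℓ)
    ℓ+m∈   : X (ℓ ℕ.+ m)
    m+k∈   : X (m ℕ.+ k)
    k+ℓ+m∈ : X (k ℕ.+ ℓ ℕ.+ m)

module _ (α : ℝ) (0<α : 0ℝ < α) where

  S : Pred ℕ 0ℓ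
  S k = ∃[ n ] 1 ℕ.≤ n × α ^-½[ 0<α ] ≤ fromℕ n × ⌊ (n ℕ.^ 2) · α ⌋≡ k

  Tα : Pred (ℕ × ℕ × ℕ) 0ℓ
  Tα = T S

  InRange : ℝ → ℕ → Set
  InRange x n = 1 ℕ.≤ n × α ^-½[ 0<α ] ≤ fromℕ n × fromℕ n ≤ x

  T≤ : ℝ → Pred (ℕ × ℕ × ℕ) 0ℓ
  T≤ x (k , ℓ , m) = Tα (k , ℓ , m) ×
    (∃[ n₁ ] ∃[ n₂ ] ∃[ n₃ ]
        InRange x n₁ × InRange x n₂ × InRange x n₃
      × ⌊ (n₁ ℕ.^ 2) · α ⌋≡ k
      × ⌊ (n₂ ℕ.^ 2) · α ⌋≡ ℓ
      × ⌊ (n₃ ℕ.^ 2) · α ⌋≡ m)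

1<⇒0< : ∀ x → 1ℝ < x → 0ℝ < x
1<⇒0< x (q , 1<q , Lq) = q , ℚₚ.<-trans (ℚₚ.positive⁻¹ 1ℚ) 1<q , Lq

-- The graph of the function x ↦ #T_{≤x}(α) / x on (1, ∞).

T≤Ratio : (α : ℝ) → 0ℝ < α → ℝ → ℝ → Set₁
T≤Ratio α 0<α x y = Σ[ 1<x ∈ 1ℝ < x ] ∃[ c ]
  HasCardinality (T≤ α 0<α x) c × y ≡ c / x [ 1<⇒0< x 1<x ]

-- The diagonals are positive because the edges are.

record PerfectEulerBrick : Set where
  field
    a b c        : ℕ
    dab dbc dca  : ℕ
    d            : ℕ
    a≥1          : 1 ℕ.≤ a
    b≥1          : 1 ℕ.≤ b
    c≥1          : 1 ℕ.≤ c
    face-ab      : a ℕ.^ 2 ℕ.+ b ℕ.^ 2 ≡ dab ℕ.^ 2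
    face-bc      : b ℕ.^ 2 ℕ.+ c ℕ.^ 2 ≡ dbc ℕ.^ 2
    face-ca      : c ℕ.^ 2 ℕ.+ a ℕ.^ 2 ≡ dca ℕ.^ 2
    space        : a ℕ.^ 2 ℕ.+ b ℕ.^ 2 ℕ.+ c ℕ.^ 2 ≡ d ℕ.^ 2

{-# OPTIONS --safe #-}

-- Let (a, b, c) be a brick with space diagonal d. If the fractional part of αn² is less
-- than 1/d², then ⌊α(ne)²⌋ = e²⌊αn²⌋ for every e ≤ d, so the floors of α(na)², α(nb)², α(nc)²
-- form a tuple of T(α). It remains to see that such n have positive lower density.
-- Colouring j by αj² mod 1, van der Waerden's theorem for progressions of length 3 gives
-- δ ≤ W with 2αδ² close to an integer, where W is independent of α. If αn² falls just below
-- an integer instead of just above it, a suitable multiple of n repairs this, so some t has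
-- fractional part of αt² in [0, 1/d²). If αt² is an integer, take the multiples of t;
-- otherwise take n = t + p, where both 2αtp and αp² are close to integers, and p is found
-- among the numbers 2mδ with δ ≤ W, for each m.
-- The conclusion being negative, case distinctions on reals are harmless, and for finitely
-- many n at a time α may be replaced by a rational u > α with the same floors.

module Submission where

module Arithmetic where
  open import Algebra.Properties.CommutativeSemigroup using (xy∙z≈xz∙y)
  open import Data.Empty using (⊥)
  open import Data.Fin as Fin using (Fin; toℕ; fromℕ<; combine; finToFun; funToFin)
  import Data.Fin.Properties as Fin
  open import Data.Integer as ℤ using (ℤ; -[1+_])
  import Data.Integer.Properties as ℤ
  import Data.Integer.Tactic.RingSolver as ℤ-solver
  open import Data.Nat
  open import Data.Nat.Coprimality using (Coprime; coprime-divisor)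
  open import Data.Nat.Divisibility using (_∣_; divides; divides-refl; ∣-trans; ∣-antisym; ∣1⇒≡1; ∣m+n∣m⇒∣n; ∣m⇒∣m*n; m∣m*n; m≤n⇒m!∣n!)
  open import Data.Nat.DivMod
  open import Data.Nat.Properties
  open import Data.Nat.Tactic.RingSolver using (solve-∀)
  open import Data.Product using (Σ-syntax; ∃; ∃-syntax; ∃₂; _×_; _,_; proj₁; proj₂)
  open import Data.Sum using (_⊎_; inj₁; inj₂)
  open import Data.Vec.Functional as Vector using ()
  open import Defs using (PerfectEulerBrick)
  open import Relation.Binary.Definitions using (tri<; tri≈; tri>)
  open import Relation.Binary.PropositionalEquality
  open import Relation.Nullary using (¬_; yes; no; contradiction)
  open import Relation.Unary using (Decidable)

  *-swapʳ : ∀ x y z → x * y * z ≡ x * z * y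
  *-swapʳ = xy∙z≈xz∙y *-commutativeSemigroup

  *-distrib-divMod : ∀ g r f Q → g * (r + f * Q) ≡ g * r + g * f * Q
  *-distrib-divMod = solve-∀

  -- Progressions of length 3

  MonoAP : ∀ {r} → (ℕ → Fin r) → ℕ → Set
  MonoAP f E = ∃[ a ] ∃[ d ] 1 ≤ d × a + d + d < E × f a ≡ f (a + d) × f (a + d) ≡ f (a + d + d)

  -- Colour focusing: `s` pairs in distinct colours, each extending to a progression whose third
  -- term is the common focus `e`. The colour of `e` itself is left open.
  Focused : ∀ {r} → (ℕ → Fin r) → ℕ → ℕ → Set
  Focused {r} f E s = ∃[ e ] e < E × Σ[ c ∈ (Fin s → Fin r) ]
      (∀ i j → i Fin.< j → c i ≢ c j)
    × (∀ i → ∃[ a ] ∃[ d ] 1 ≤ d × a + d + d ≡ e × f a ≡ c i × f (a + d) ≡ c i)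

  -- Induction on `s`. Among `r ^ E + 1` blocks of length `E` two are coloured alike, at distance
  -- `D`. The induction hypothesis is applied in the first of them, and a second stretch of length
  -- `B * E` leaves room for a focus moved by `2D`.
  focusing : ∀ r s → ∃[ E ] 1 ≤ E × ((f : ℕ → Fin r) → MonoAP f E ⊎ Focused f E s)
  focusing r zero = 1 , ≤-refl , λ f → inj₂ (0 , ≤-refl , (λ ()) , (λ ()) , λ ())
  focusing r (suc s) with focusing r s
  ... | E , 1≤E , focus = B * E + B * E , ≤-trans 1≤E (≤-trans (m≤m+n E (r ^ E * E)) (m≤m+n _ _)) , step
    where
    B : ℕ
    B = suc (r ^ E)

    step : (f : ℕ → Fin r) → MonoAP f (B * E + B * E) ⊎ Focused f (B * E + B * E) (suc s)
    step f = extend (focus (λ x → f (u + x)))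
      where
      block : Fin B → Fin (r ^ E)
      block b = funToFin λ (x : Fin E) → f (toℕ b * E + toℕ x)

      collision : ∃₂ λ b b′ → b Fin.< b′ × block b ≡ block b′
      collision = Fin.pigeonhole (n<1+n _) block

      b b′ : Fin B
      b  = proj₁ collision
      b′ = proj₁ (proj₂ collision)

      gap : ∃[ k ] suc (toℕ b) + k ≡ toℕ b′
      gap = m≤n⇒∃[o]m+o≡n (proj₁ (proj₂ (proj₂ collision)))

      u D : ℕ
      u = toℕ b * E
      D = suc (proj₁ gap) * E

      1≤D : 1 ≤ D
      1≤D = ≤-trans 1≤E (m≤m+n E _)

      u+D≡b′E : u + D ≡ toℕ b′ * E
      u+D≡b′E = trans (identity (toℕ b) (proj₁ gap) E) (cong (_* E) (proj₂ gap))
        where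
        identity : ∀ b k E → b * E + suc k * E ≡ (suc b + k) * E
        identity = solve-∀

      u+D+E≤BE : u + D + E ≤ B * E
      u+D+E≤BE = begin
        u + D + E         ≡⟨ cong (_+ E) u+D≡b′E ⟩
        toℕ b′ * E + E    ≡⟨ +-comm (toℕ b′ * E) E ⟩
        suc (toℕ b′) * E  ≤⟨ *-monoˡ-≤ E (Fin.toℕ<n b′) ⟩
        B * E             ∎
        where open ≤-Reasoning

      repeats : ∀ {x} → x < E → f (u + x) ≡ f (u + D + x)
      repeats {x} x<E = subst₂ _≡_
        (trans (Fin.finToFun-funToFin _ i) (cong (λ x → f (u + x)) (Fin.toℕ-fromℕ< x<E)))
        (trans (Fin.finToFun-funToFin _ i) (cong₂ (λ v x → f (v + x)) (sym u+D≡b′E) (Fin.toℕ-fromℕ< x<E)))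
        (cong (λ c → finToFun {r} {E} c i) (proj₂ (proj₂ (proj₂ collision))))
        where
        i : Fin E
        i = fromℕ< x<E

      D≤BE : D ≤ B * E
      D≤BE = ≤-trans (≤-trans (m≤n+m D u) (m≤m+n _ E)) u+D+E≤BE

      u+x<2BE : ∀ {x} → x < E → u + x < B * E + B * E
      u+x<2BE {x} x<E = begin-strict
        u + x          <⟨ +-monoʳ-< u x<E ⟩
        u + E          ≤⟨ +-monoˡ-≤ E (m≤m+n u D) ⟩
        u + D + E      ≤⟨ u+D+E≤BE ⟩
        B * E          ≤⟨ m≤m+n (B * E) (B * E) ⟩
        B * E + B * E  ∎
        where open ≤-Reasoning

      focus<2BE : ∀ {x} → x < E → u + x + D + D < B * E + B * E
      focus<2BE {x} x<E = begin-strict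
        u + x + D + D    ≡⟨ identity u x D ⟩
        (u + D + x) + D  <⟨ +-monoˡ-< D (+-monoʳ-< (u + D) x<E) ⟩
        (u + D + E) + D  ≤⟨ +-mono-≤ u+D+E≤BE D≤BE ⟩
        B * E + B * E    ∎
        where
        open ≤-Reasoning
        identity : ∀ u x D → u + x + D + D ≡ (u + D + x) + D
        identity = solve-∀

      extend : MonoAP (λ x → f (u + x)) E ⊎ Focused (λ x → f (u + x)) E s →
               MonoAP f (B * E + B * E) ⊎ Focused f (B * E + B * E) (suc s)
      extend (inj₁ (a , d , 1≤d , bound , p , q)) =
        inj₁ (u + a , d , 1≤d , subst (_< B * E + B * E) assoc₃ (u+x<2BE bound)
             , trans p (cong f assoc₂) , subst₂ (λ x y → f x ≡ f y) assoc₂ assoc₃ q)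
        where
        assoc₂ : u + (a + d) ≡ u + a + d
        assoc₂ = sym (+-assoc u a d)
        assoc₃ : u + (a + d + d) ≡ u + a + d + d
        assoc₃ = trans (sym (+-assoc u (a + d) d)) (cong (_+ d) assoc₂)
      extend (inj₂ (e , e<E , c , distinct , aps))
        with Fin.any? (λ i → f (u + e) Fin.≟ c i)
      -- The focus has the colour of one of the pairs and completes it to a monochromatic
      -- progression.
      ... | yes (i , fe≡ci) =
        let a , d , 1≤d , a+2d≡e , p , q = aps i in
        inj₁ (u + a , d , 1≤d
             , subst (_< B * E + B * E) (sym (shift a d a+2d≡e)) (u+x<2BE e<E)
             , trans p (trans (sym q) (cong f (sym (+-assoc u a d))))
             , trans (cong f (+-assoc u a d)) (trans q (trans (sym fe≡ci) (cong f (sym (shift a d a+2d≡e))))))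
        where
        shift : ∀ a d → a + d + d ≡ e → u + a + d + d ≡ u + e
        shift a d eq = trans (identity u a d) (cong (u +_) eq)
          where
          identity : ∀ u a d → u + a + d + d ≡ u + (a + d + d)
          identity = solve-∀
      ... | no fe≢c =
        -- Otherwise the old focus and its copy at distance `D` form a pair in a new colour. Each
        -- old pair keeps its first term and takes the second from the copied block, so that all
        -- third terms meet `2D` beyond the old focus.
        inj₂ (u + e + D + D , focus<2BE e<E , f (u + e) Vector.∷ c , distinct′ , aps′)
        where
        distinct′ : ∀ i j → i Fin.< j → (f (u + e) Vector.∷ c) i ≢ (f (u + e) Vector.∷ c) j
        distinct′ Fin.zero    (Fin.suc j) _         eq = fe≢c (j , eq)
        distinct′ (Fin.suc i) (Fin.suc j) (s≤s i<j) eq = distinct i j i<j eq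

        aps′ : ∀ i → ∃[ a ] ∃[ d ] 1 ≤ d × a + d + d ≡ u + e + D + D
               × f a ≡ (f (u + e) Vector.∷ c) i × f (a + d) ≡ (f (u + e) Vector.∷ c) i
        aps′ Fin.zero = u + e , D , 1≤D , refl , refl
          , trans (cong f (commute u e D)) (sym (repeats e<E))
          where
          commute : ∀ u e D → u + e + D ≡ u + D + e
          commute = solve-∀
        aps′ (Fin.suc i) =
          let a , d , 1≤d , a+2d≡e , p , q = aps i in
          u + a , d + D , ≤-trans 1≤d (m≤m+n d D)
          , trans (stretch u a d D) (cong (λ e → u + e + D + D) a+2d≡e)
          , p
          , trans (cong f (move u a d D)) (trans (sym (repeats (≤-<-trans (m≤m+n _ d) (subst (_< E) (sym a+2d≡e) e<E)))) q)
          where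
          stretch : ∀ u a d D → u + a + (d + D) + (d + D) ≡ u + (a + d + d) + D + D
          stretch = solve-∀
          move : ∀ u a d D → u + a + (d + D) ≡ u + D + (a + d)
          move = solve-∀

  abstract
    -- With `r` colours there cannot be `r + 1` pairs in distinct colours, so only the first
    -- alternative of `focusing` remains.
    vanDerWaerden₃ : ∀ r → ∃[ W ] ((f : ℕ → Fin r) → MonoAP f W)
    vanDerWaerden₃ r with focusing r (suc r)
    ... | W , _ , focus = W , λ f → mono (focus f)
      where
      mono : ∀ {f : ℕ → Fin r} → MonoAP f W ⊎ Focused f W (suc r) → MonoAP f W
      mono (inj₁ ap) = ap
      mono (inj₂ (_ , _ , c , distinct , _)) =
        let i , j , i<j , ci≡cj = Fin.pigeonhole (n<1+n r) c in contradiction ci≡cj (distinct i j i<j)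

  -- Recurrence

  -- The h cells are the intervals [ i/h , (i+1)/h ) of ℝ/ℤ, and x stands for x/Q.
  module _ (h Q : ℕ) .{{_ : NonZero h}} .{{_ : NonZero Q}} where

    cell : ℕ → Fin h
    cell x = fromℕ< (m<n*o⇒m/o<n {h * (x % Q)} {h} {Q} (*-monoʳ-< h (m%n<n x Q)))

    rem : ℕ → ℤ
    rem x = ℤ.+ (x % Q)

    -- In a common cell, `h * (x % Q)` and `h * (y % Q)` have the same quotient by `Q`, so their
    -- difference is a difference of two remainders.
    same-cell : ∀ {x y} → cell x ≡ cell y → h * ℤ.∣ rem x ℤ.- rem y ∣ ≤ Q
    same-cell {x} {y} eq = begin
      h * ℤ.∣ rem x ℤ.- rem y ∣                        ≡⟨ ℤ.abs-* (ℤ.+ h) _ ⟨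
      ℤ.∣ ℤ.+ h ℤ.* (rem x ℤ.- rem y) ∣                ≡⟨ cong ℤ.∣_∣ difference ⟩
      ℤ.∣ ℤ.+ (hx % Q) ℤ.- ℤ.+ (hy % Q) ∣              ≡⟨ cong ℤ.∣_∣ (ℤ.[+m]-[+n]≡m⊖n (hx % Q) (hy % Q)) ⟩
      ℤ.∣ (hx % Q) ℤ.⊖ (hy % Q) ∣                      ≤⟨ ℤ.∣m⊝n∣≤m⊔n (hx % Q) (hy % Q) ⟩
      hx % Q ⊔ hy % Q                                  ≤⟨ ⊔-lub (m%n≤n hx Q) (m%n≤n hy Q) ⟩
      Q                                                ∎
      where
      open ≤-Reasoning
      hx hy : ℕ
      hx = h * (x % Q)
      hy = h * (y % Q)

      quotients : hx / Q ≡ hy / Q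
      quotients = Fin.fromℕ<-injective (hx / Q) (hy / Q) _ _ eq

      split : ∀ z → ℤ.+ h ℤ.* rem z ≡ ℤ.+ (h * (z % Q) % Q) ℤ.+ ℤ.+ (h * (z % Q) / Q * Q)
      split z = trans (sym (ℤ.pos-* h (z % Q))) (cong ℤ.+_ (m≡m%n+[m/n]*n (h * (z % Q)) Q))

      cancel : ∀ h a b c d k → h ℤ.* a ≡ c ℤ.+ k → h ℤ.* b ≡ d ℤ.+ k → h ℤ.* (a ℤ.- b) ≡ c ℤ.- d
      cancel h a b c d k p q = trans (expand h a b) (trans (cong₂ ℤ._-_ p q) (collapse c d k))
        where
        expand : ∀ h a b → h ℤ.* (a ℤ.- b) ≡ h ℤ.* a ℤ.- h ℤ.* b
        expand = ℤ-solver.solve-∀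
        collapse : ∀ c d k → (c ℤ.+ k) ℤ.- (d ℤ.+ k) ≡ c ℤ.- d
        collapse = ℤ-solver.solve-∀

      difference : ℤ.+ h ℤ.* (rem x ℤ.- rem y) ≡ ℤ.+ (hx % Q) ℤ.- ℤ.+ (hy % Q)
      difference = cancel (ℤ.+ h) (rem x) (rem y) (ℤ.+ (hx % Q)) (ℤ.+ (hy % Q)) (ℤ.+ (hx / Q * Q)) (split x)
        (trans (split y) (cong (λ k → ℤ.+ (hy % Q) ℤ.+ ℤ.+ (k * Q)) (sym quotients)))

  -- Modulo 1, the polynomial `(β n + γ n²) / Q` comes within `6 / h` of 0 at some even `n = 2d`.
  -- What matters is that `W` is fixed before `Q`, `β` and `γ`.
  Recurrent : ℕ → ℕ → Set
  Recurrent h W = ∀ Q .{{_ : NonZero Q}} β γ → ∃[ d ] 1 ≤ d × d ≤ W × ∃[ z ] ∃[ e ]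
    ℤ.+ (β * (2 * d) + γ * ((2 * d) * (2 * d))) ≡ z ℤ.* ℤ.+ Q ℤ.+ e × h * ℤ.∣ e ∣ ≤ 6 * Q

  -- Colour j by the cells of βj and γj². A monochromatic progression a, a+d, a+2d controls
  -- the first difference βd of the one and the second difference 2γd² of the other.
  progressions⇒recurrent : ∀ h .{{_ : NonZero h}} {W} → (∀ (f : ℕ → Fin (h * h)) → MonoAP f W) → Recurrent h W
  progressions⇒recurrent h {W} progression Q β γ = from (progression colour)
    where
    colour : ℕ → Fin (h * h)
    colour j = combine (cell h Q (β * j)) (cell h Q (γ * (j * j)))

    from : MonoAP colour W → ∃[ d ] 1 ≤ d × d ≤ W × ∃[ z ] ∃[ e ]
      ℤ.+ (β * (2 * d) + γ * ((2 * d) * (2 * d))) ≡ z ℤ.* ℤ.+ Q ℤ.+ e × h * ℤ.∣ e ∣ ≤ 6 * Q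
    from (a , d , 1≤d , bound , p , q) =
      d , 1≤d , <⇒≤ (≤-<-trans (m≤n+m d _) bound) , z , e , decomposition , e-small
      where
      x₀ x₁ y₀ y₁ y₂ : ℕ
      x₀ = β * a
      x₁ = β * (a + d)
      y₀ = γ * (a * a)
      y₁ = γ * ((a + d) * (a + d))
      y₂ = γ * ((a + d + d) * (a + d + d))

      r : ℕ → ℤ
      r = rem h Q

      cells₁ = Fin.combine-injective (cell h Q x₀) (cell h Q y₀) (cell h Q x₁) (cell h Q y₁) p
      cells₂ = Fin.combine-injective (cell h Q x₁) (cell h Q y₁) (cell h Q (β * (a + d + d))) (cell h Q y₂) q

      u v w z e : ℤ
      u = r x₁ ℤ.- r x₀
      v = r y₀ ℤ.- r y₁
      w = r y₂ ℤ.- r y₁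
      -- Here `β · 2d = 2(x₁ - x₀)` and `γ · 4d² = 2(y₀ - y₁) + 2(y₂ - y₁)`. These six differences
      -- within cells account for the 6 in `Recurrent`.
      e = (u ℤ.+ u) ℤ.+ (v ℤ.+ v) ℤ.+ (w ℤ.+ w)

      k : ℕ → ℤ
      k x = ℤ.+ (x / Q)
      z = (k x₁ ℤ.+ k x₁ ℤ.- k x₀ ℤ.- k x₀) ℤ.+ (k y₀ ℤ.+ k y₀ ℤ.- k y₁ ℤ.- k y₁) ℤ.+ (k y₂ ℤ.+ k y₂ ℤ.- k y₁ ℤ.- k y₁)

      -- Subtraction on ℕ is avoided by adding the negative terms on the left; `isolate` moves them
      -- back in ℤ.
      differences : ∀ β γ a d →
        β * (2 * d) + γ * ((2 * d) * (2 * d))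
          + (β * a + β * a + (γ * ((a + d) * (a + d)) + γ * ((a + d) * (a + d))) + (γ * ((a + d) * (a + d)) + γ * ((a + d) * (a + d))))
        ≡ (β * (a + d) + β * (a + d)) + (γ * (a * a) + γ * (a * a)) + (γ * ((a + d + d) * (a + d + d)) + γ * ((a + d + d) * (a + d + d)))
      differences = solve-∀

      isolate : ∀ X x₀ x₁ y₀ y₁ y₂ →
        X ℤ.+ (x₀ ℤ.+ x₀ ℤ.+ (y₁ ℤ.+ y₁) ℤ.+ (y₁ ℤ.+ y₁)) ≡ (x₁ ℤ.+ x₁) ℤ.+ (y₀ ℤ.+ y₀) ℤ.+ (y₂ ℤ.+ y₂) →
        X ≡ (x₁ ℤ.+ x₁ ℤ.- x₀ ℤ.- x₀) ℤ.+ (y₀ ℤ.+ y₀ ℤ.- y₁ ℤ.- y₁) ℤ.+ (y₂ ℤ.+ y₂ ℤ.- y₁ ℤ.- y₁)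
      isolate X x₀ x₁ y₀ y₁ y₂ eq =
        trans (insert X _) (trans (cong (ℤ._- _) eq) (collect x₀ x₁ y₀ y₁ y₂))
        where
        insert : ∀ X Y → X ≡ X ℤ.+ Y ℤ.- Y
        insert = ℤ-solver.solve-∀
        collect : ∀ x₀ x₁ y₀ y₁ y₂ →
          ((x₁ ℤ.+ x₁) ℤ.+ (y₀ ℤ.+ y₀) ℤ.+ (y₂ ℤ.+ y₂)) ℤ.- (x₀ ℤ.+ x₀ ℤ.+ (y₁ ℤ.+ y₁) ℤ.+ (y₁ ℤ.+ y₁))
          ≡ (x₁ ℤ.+ x₁ ℤ.- x₀ ℤ.- x₀) ℤ.+ (y₀ ℤ.+ y₀ ℤ.- y₁ ℤ.- y₁) ℤ.+ (y₂ ℤ.+ y₂ ℤ.- y₁ ℤ.- y₁)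
        collect = ℤ-solver.solve-∀

      divide : ∀ x → ℤ.+ x ≡ r x ℤ.+ k x ℤ.* ℤ.+ Q
      divide x = trans (cong ℤ.+_ (m≡m%n+[m/n]*n x Q)) (cong (λ i → r x ℤ.+ i) (ℤ.pos-* (x / Q) Q))

      regroup : ∀ r₀ r₁ s₀ s₁ s₂ k₀ k₁ l₀ l₁ l₂ Q →
        let x₀ = r₀ ℤ.+ k₀ ℤ.* Q; x₁ = r₁ ℤ.+ k₁ ℤ.* Q
            y₀ = s₀ ℤ.+ l₀ ℤ.* Q; y₁ = s₁ ℤ.+ l₁ ℤ.* Q; y₂ = s₂ ℤ.+ l₂ ℤ.* Q in
        (x₁ ℤ.+ x₁ ℤ.- x₀ ℤ.- x₀) ℤ.+ (y₀ ℤ.+ y₀ ℤ.- y₁ ℤ.- y₁) ℤ.+ (y₂ ℤ.+ y₂ ℤ.- y₁ ℤ.- y₁)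
        ≡ ((k₁ ℤ.+ k₁ ℤ.- k₀ ℤ.- k₀) ℤ.+ (l₀ ℤ.+ l₀ ℤ.- l₁ ℤ.- l₁) ℤ.+ (l₂ ℤ.+ l₂ ℤ.- l₁ ℤ.- l₁)) ℤ.* Q
          ℤ.+ (((r₁ ℤ.- r₀) ℤ.+ (r₁ ℤ.- r₀)) ℤ.+ ((s₀ ℤ.- s₁) ℤ.+ (s₀ ℤ.- s₁)) ℤ.+ ((s₂ ℤ.- s₁) ℤ.+ (s₂ ℤ.- s₁)))
      regroup = ℤ-solver.solve-∀

      decomposition : ℤ.+ (β * (2 * d) + γ * ((2 * d) * (2 * d))) ≡ z ℤ.* ℤ.+ Q ℤ.+ e
      decomposition = trans
        (isolate _ (r x₀ ℤ.+ k x₀ ℤ.* ℤ.+ Q) (r x₁ ℤ.+ k x₁ ℤ.* ℤ.+ Q)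
           (r y₀ ℤ.+ k y₀ ℤ.* ℤ.+ Q) (r y₁ ℤ.+ k y₁ ℤ.* ℤ.+ Q) (r y₂ ℤ.+ k y₂ ℤ.* ℤ.+ Q)
           (trans (cong₂ (λ x y → ℤ.+ (β * (2 * d) + γ * ((2 * d) * (2 * d))) ℤ.+ (x ℤ.+ x ℤ.+ (y ℤ.+ y) ℤ.+ (y ℤ.+ y)))
                     (sym (divide x₀)) (sym (divide y₁)))
             (trans (cong ℤ.+_ (differences β γ a d))
               (cong₂ ℤ._+_ (cong₂ (λ x y → (x ℤ.+ x) ℤ.+ (y ℤ.+ y)) (divide x₁) (divide y₀))
                            (cong (λ y → y ℤ.+ y) (divide y₂))))))
        (regroup (r x₀) (r x₁) (r y₀) (r y₁) (r y₂) (k x₀) (k x₁) (k y₀) (k y₁) (k y₂) (ℤ.+ Q))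

      triangle : ∀ i j {m n} → h * ℤ.∣ i ∣ ≤ m → h * ℤ.∣ j ∣ ≤ n → h * ℤ.∣ i ℤ.+ j ∣ ≤ m + n
      triangle i j {m} {n} hi≤m hj≤n = begin
        h * ℤ.∣ i ℤ.+ j ∣            ≤⟨ *-monoʳ-≤ h (ℤ.∣i+j∣≤∣i∣+∣j∣ i j) ⟩
        h * (ℤ.∣ i ∣ + ℤ.∣ j ∣)      ≡⟨ *-distribˡ-+ h ℤ.∣ i ∣ ℤ.∣ j ∣ ⟩
        h * ℤ.∣ i ∣ + h * ℤ.∣ j ∣    ≤⟨ +-mono-≤ hi≤m hj≤n ⟩
        m + n                        ∎
        where open ≤-Reasoning

      u-small : h * ℤ.∣ u ∣ ≤ Q
      u-small = same-cell h Q (sym (proj₁ cells₁))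
      v-small : h * ℤ.∣ v ∣ ≤ Q
      v-small = same-cell h Q (proj₂ cells₁)
      w-small : h * ℤ.∣ w ∣ ≤ Q
      w-small = same-cell h Q (sym (proj₂ cells₂))

      six : ∀ Q → (Q + Q) + (Q + Q) + (Q + Q) ≡ 6 * Q
      six = solve-∀

      e-small : h * ℤ.∣ e ∣ ≤ 6 * Q
      e-small = subst (h * ℤ.∣ e ∣ ≤_) (six Q)
        (triangle ((u ℤ.+ u) ℤ.+ (v ℤ.+ v)) (w ℤ.+ w)
          (triangle (u ℤ.+ u) (v ℤ.+ v) (triangle u u u-small u-small) (triangle v v v-small v-small))
          (triangle w w w-small w-small))

  abstract
    recurrence : ∀ h .{{_ : NonZero h}} → ∃[ W ] Recurrent h W
    recurrence h = let W , progression = vanDerWaerden₃ (h * h) in W , progressions⇒recurrent h progression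

  -- Rational approximations from above

  -- Search downwards from `g + h`; the first success is the largest one below `g + h`.
  last : ∀ {P : ℕ → Set} → Decidable P → ∀ g {h} → P h → ¬ P (g + h) →
         ∃[ k ] h ≤ k × k < g + h × P k × ¬ P (suc k)
  last P? zero    Ph ¬P = contradiction Ph ¬P
  last P? (suc g) {h} Ph ¬P with P? (g + h)
  ... | yes P = g + h , m≤n+m h g , ≤-refl , P , ¬P
  ... | no ¬Pg = let k , h≤k , k<g+h , Pk , ¬Psk = last P? g Ph ¬Pg in
                 k , h≤k , m<n⇒m<1+n k<g+h , Pk , ¬Psk

  -- A negative quotient would make `X` negative, because `r < Q`.
  natural-quotient : ∀ {X z r Q} → ℤ.+ X ≡ z ℤ.* ℤ.+ Q ℤ.+ ℤ.+ r → r < Q → ∃[ f ] X ≡ r + f * Q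
  natural-quotient {X} {ℤ.+ f} {r} {Q} eq _ =
    f , trans (ℤ.+-injective (trans eq (cong (λ i → i ℤ.+ ℤ.+ r) (sym (ℤ.pos-* f Q))))) (+-comm (f * Q) r)
  natural-quotient {X} { -[1+ k ]} {r} {Q} eq r<Q = contradiction r<Q (≤⇒≯ (begin
    Q                  ≤⟨ m≤m+n Q (k * Q) ⟩
    suc k * Q          ≤⟨ m≤n+m (suc k * Q) X ⟩
    X + suc k * Q      ≡⟨ ℤ.+-injective (trans (cong₂ ℤ._+_ eq (ℤ.pos-* (suc k) Q)) (cancel (ℤ.+ suc k) (ℤ.+ Q) (ℤ.+ r))) ⟩
    r                  ∎))
    where
    open ≤-Reasoning
    cancel : ∀ k Q r → (ℤ.- k) ℤ.* Q ℤ.+ r ℤ.+ k ℤ.* Q ≡ r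
    cancel = ℤ-solver.solve-∀

  natural-quotient⁻ : ∀ {X z r Q} → ℤ.+ X ≡ z ℤ.* ℤ.+ Q ℤ.+ -[1+ r ] → ∃[ f ] X + suc r ≡ f * Q
  natural-quotient⁻ {X} {ℤ.+ f} {r} {Q} eq =
    f , ℤ.+-injective (trans (cong (λ i → i ℤ.+ ℤ.+ suc r) eq)
          (trans (cancel (ℤ.+ f ℤ.* ℤ.+ Q) (ℤ.+ suc r)) (sym (ℤ.pos-* f Q))))
    where
    cancel : ∀ x s → x ℤ.+ (ℤ.- s) ℤ.+ s ≡ x
    cancel = ℤ-solver.solve-∀
  natural-quotient⁻ {X} { -[1+ k ]} {r} {Q} eq = contradiction zero′ λ ()
    where
    cancel : ∀ k Q s → (ℤ.- k) ℤ.* Q ℤ.+ (ℤ.- s) ℤ.+ (s ℤ.+ k ℤ.* Q) ≡ ℤ.+ 0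
    cancel = ℤ-solver.solve-∀
    zero′ : suc (r + suc k * Q + X) ≡ 0
    zero′ = trans (+-comm (suc r + suc k * Q) X) (ℤ.+-injective
      (trans (cong₂ ℤ._+_ eq (cong (λ i → ℤ.+ suc r ℤ.+ i) (ℤ.pos-* (suc k) Q)))
             (cancel (ℤ.+ suc k) (ℤ.+ Q) (ℤ.+ suc r))))

  -- A nonnegative rational, not necessarily in lowest terms; storing `den-1` makes the denominator
  -- nonzero by definition.
  record Fraction : Set where
    constructor _/1+_
    field
      num den-1 : ℕ
    den : ℕ
    den = suc den-1

  open Fraction public

  infix 4 _⊑_

  _⊑_ : Fraction → Fraction → Set
  u ⊑ w = num u * den w ≤ num w * den u

  ⊑-refl : ∀ {u} → u ⊑ u
  ⊑-refl = ≤-refl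

  ⊑-trans : ∀ {u v w} → u ⊑ v → v ⊑ w → u ⊑ w
  ⊑-trans {u} {v} {w} u⊑v v⊑w = *-cancelʳ-≤ (num u * den w) (num w * den u) (den v) (begin
    num u * den w * den v  ≡⟨ *-swapʳ (num u) (den w) (den v) ⟩
    num u * den v * den w  ≤⟨ *-monoˡ-≤ (den w) u⊑v ⟩
    num v * den u * den w  ≡⟨ *-swapʳ (num v) (den u) (den w) ⟩
    num v * den w * den u  ≤⟨ *-monoˡ-≤ (den u) v⊑w ⟩
    num w * den v * den u  ≡⟨ *-swapʳ (num w) (den v) (den u) ⟩
    num w * den u * den v  ∎)
    where
    open ≤-Reasoning

  abstract
    ⌊_⟨_⟩²⌋ : Fraction → ℕ → ℕ
    ⌊ u ⟨ n ⟩²⌋ = num u * (n * n) / den u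

    floor-lower : ∀ u n → ⌊ u ⟨ n ⟩²⌋ * den u ≤ num u * (n * n)
    floor-lower u n = m/n*n≤m (num u * (n * n)) (den u)

    floor-upper : ∀ u n → num u * (n * n) < suc ⌊ u ⟨ n ⟩²⌋ * den u
    floor-upper u n = begin-strict
      num u * (n * n)                                        ≡⟨ m≡m%n+[m/n]*n (num u * (n * n)) (den u) ⟩
      num u * (n * n) % den u + ⌊ u ⟨ n ⟩²⌋ * den u          <⟨ +-monoˡ-< _ (m%n<n (num u * (n * n)) (den u)) ⟩
      den u + ⌊ u ⟨ n ⟩²⌋ * den u                            ∎
      where open ≤-Reasoning

    floor-greatest : ∀ u n k → k * den u ≤ num u * (n * n) → k ≤ ⌊ u ⟨ n ⟩²⌋
    floor-greatest u n k k≤un² = subst (_≤ ⌊ u ⟨ n ⟩²⌋) (m*n/n≡m k (den u)) (/-monoˡ-≤ (den u) k≤un²)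

    floor-unique : ∀ u n r f → num u * (n * n) ≡ r + f * den u → r < den u → ⌊ u ⟨ n ⟩²⌋ ≡ f
    floor-unique u n r f eq r<Q = begin
      num u * (n * n) / den u            ≡⟨ cong (_/ den u) (trans eq (+-comm r (f * den u))) ⟩
      (f * den u + r) / den u            ≡⟨ +-distrib-/-∣ˡ r (divides-refl f) ⟩
      f * den u / den u + r / den u      ≡⟨ cong₂ _+_ (m*n/n≡m f (den u)) (m<n⇒m/n≡0 r<Q) ⟩
      f + 0                              ≡⟨ +-identityʳ f ⟩
      f                                  ∎
      where open ≡-Reasoning

  floor-mono : ∀ u w n → u ⊑ w → ⌊ u ⟨ n ⟩²⌋ ≤ ⌊ w ⟨ n ⟩²⌋
  floor-mono u w n u⊑w = floor-greatest w n ⌊ u ⟨ n ⟩²⌋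
    (*-cancelʳ-≤ (⌊ u ⟨ n ⟩²⌋ * den w) (num w * (n * n)) (den u) (begin
      ⌊ u ⟨ n ⟩²⌋ * den w * den u  ≡⟨ *-swapʳ ⌊ u ⟨ n ⟩²⌋ (den w) (den u) ⟩
      ⌊ u ⟨ n ⟩²⌋ * den u * den w  ≤⟨ *-monoˡ-≤ (den w) (floor-lower u n) ⟩
      num u * (n * n) * den w      ≡⟨ *-swapʳ (num u) (n * n) (den w) ⟩
      num u * den w * (n * n)      ≤⟨ *-monoˡ-≤ (n * n) u⊑w ⟩
      num w * den u * (n * n)      ≡⟨ *-swapʳ (num w) (den u) (n * n) ⟩
      num w * (n * n) * den u      ∎))
    where
    open ≤-Reasoning

  -- The fractional part of `u n²` is `r / den u`, so the inequality puts it below `1 / D`.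
  SmallFraction : ℕ → Fraction → ℕ → Set
  SmallFraction D u n = ∃[ r ] num u * (n * n) ≡ r + ⌊ u ⟨ n ⟩²⌋ * den u × D * r < den u

  small-fraction : ∀ D u n r f .{{_ : NonZero D}} → num u * (n * n) ≡ r + f * den u → D * r < den u →
                   SmallFraction D u n
  small-fraction D u n r f eq Dr<Q = r , subst (λ f → num u * (n * n) ≡ r + f * den u) (sym floor≡f) eq , Dr<Q
    where
    floor≡f : ⌊ u ⟨ n ⟩²⌋ ≡ f
    floor≡f = floor-unique u n r f eq (≤-<-trans (m≤n*m r D) Dr<Q)

  -- The decreasing quantity of `sharpen`: a smaller fraction that lowers one of the floors up to
  -- `M` lowers this sum.
  total : ℕ → Fraction → ℕ
  total zero    u = ⌊ u ⟨ zero ⟩²⌋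
  total (suc M) u = total M u + ⌊ u ⟨ suc M ⟩²⌋

  total-mono : ∀ M u w → u ⊑ w → total M u ≤ total M w
  total-mono zero    u w u⊑w = floor-mono u w zero u⊑w
  total-mono (suc M) u w u⊑w = +-mono-≤ (total-mono M u w u⊑w) (floor-mono u w (suc M) u⊑w)

  total-mono-< : ∀ M u w {n} → n ≤ M → u ⊑ w → ⌊ u ⟨ n ⟩²⌋ < ⌊ w ⟨ n ⟩²⌋ → total M u < total M w
  total-mono-< zero    _ _ z≤n _ lt = lt
  total-mono-< (suc M) u w n≤M u⊑w lt with m≤n⇒m<n∨m≡n n≤M
  ... | inj₁ (s≤s n≤M′) = +-mono-<-≤ (total-mono-< M u w n≤M′ u⊑w lt) (floor-mono u w (suc M) u⊑w)
  ... | inj₂ refl       = +-mono-≤-< (total-mono M u w u⊑w) lt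

  -- V u stands for α < u, where α is a positive real.
  module Upper (V : Fraction → Set) where

    -- The floors of αn² and of un² agree for n ≤ M.
    Sharp : ℕ → Fraction → Set
    Sharp M u = V u × (∀ w → V w → ∀ n → n ≤ M → ⌊ u ⟨ n ⟩²⌋ ≤ ⌊ w ⟨ n ⟩²⌋)

    -- If `u` is not sharp, some `w` in `V` has a smaller floor. By monotonicity `w` lies below `u`,
    -- and the descent continues from `w` with a smaller `total`. Whether such a `w` exists is not
    -- decidable, hence the double negation.
    sharpen : ∀ M u → V u → ¬ ¬ (∃[ w ] w ⊑ u × Sharp M w)
    sharpen M u Vu = descend (suc (total M u)) u Vu ≤-refl
      where
      descend : ∀ k u → V u → total M u < k → ¬ ¬ (∃[ w ] w ⊑ u × Sharp M w)
      descend (suc k) u Vu (s≤s total≤k) none = none (u , ⊑-refl {u} , Vu , least)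
        where
        least : ∀ w → V w → ∀ n → n ≤ M → ⌊ u ⟨ n ⟩²⌋ ≤ ⌊ w ⟨ n ⟩²⌋
        least w Vw n n≤M with ≤-total (num u * den w) (num w * den u) | ⌊ u ⟨ n ⟩²⌋ ≤? ⌊ w ⟨ n ⟩²⌋
        ... | _        | yes u≤w = u≤w
        ... | inj₁ u⊑w | no u≰w = contradiction (floor-mono u w n u⊑w) u≰w
        ... | inj₂ w⊑u | no u≰w = contradiction
          (λ { (v , v⊑w , sharp) → none (v , ⊑-trans {v} {w} {u} v⊑w w⊑u , sharp) })
          (descend k w Vw (<-≤-trans (total-mono-< M w u n≤M w⊑u (≰⇒> u≰w)) total≤k))

    -- As `α < u` and the floors at `t` agree, the fractional part of `αt²` is below `1 / D` too.
    Seed : ℕ → ℕ → Fraction → Set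
    Seed D t u = 1 ≤ t × SmallFraction D u t × Sharp t u

    -- If un² lies just below an integer, at distance δ ≤ 1/h², then the largest k with k²δ ≤ 1
    -- is at least h, so 1 - k²δ < (2k+1)δ ≤ 3/k ≤ 1/D.
    overshoot : ∀ D .{{_ : NonZero D}} → let h = 3 * D in ∀ u n₀ s ζ →
      Sharp (h * n₀) u → 1 ≤ n₀ → 1 ≤ s → num u * (n₀ * n₀) + s ≡ ζ * den u → h * h * s ≤ den u →
      ¬ ¬ (∃[ t ] ∃[ w ] Seed D t w)
    overshoot D u n₀ s ζ (Vu , least) 1≤n₀ 1≤s eq hhs≤Q none =
      -- The multiplier `k` found below is at most `Q`, so sharpness up to `Q * n₀` covers
      -- `t = k * n₀`.
      sharpen (Q * n₀) u Vu λ { (w , w⊑u , sharp) → none (seed w w⊑u sharp) }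
      where
      h Q : ℕ
      h = 3 * D
      Q = den u

      instance
        s≢0 : NonZero s
        s≢0 = >-nonZero 1≤s
        h≢0 : NonZero h
        h≢0 = m*n≢0 3 D

      h≤Q : h ≤ Q
      h≤Q = ≤-trans (≤-trans (m≤m*n h h) (m≤m*n (h * h) s)) hhs≤Q

      1≤ζ : 1 ≤ ζ
      1≤ζ = n≢0⇒n>0 λ { refl → contradiction (m+n≡0⇒n≡0 (num u * (n₀ * n₀)) eq) (≢-nonZero⁻¹ s) }

      seed : ∀ w → w ⊑ u → Sharp (Q * n₀) w → ∃[ t ] ∃[ w ] Seed D t w
      seed w w⊑u (Vw , least′) =
        k * n₀ , w , *-mono-≤ 1≤k 1≤n₀ , small-fraction D w (k * n₀) ρ f remainder Dρ<Q′ , Vw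
        , λ v Vv n n≤t → least′ v Vv n (≤-trans n≤t (*-monoˡ-≤ n₀ k≤Q))
        where
        open ≤-Reasoning
        Q′ x y : ℕ
        Q′ = den w
        x = num u * (n₀ * n₀)
        y = num w * (n₀ * n₀)

        yQ≤xQ′ : y * Q ≤ x * Q′
        yQ≤xQ′ = begin
          y * Q                          ≡⟨ *-swapʳ (num w) (n₀ * n₀) Q ⟩
          num w * Q * (n₀ * n₀)          ≤⟨ *-monoˡ-≤ (n₀ * n₀) w⊑u ⟩
          num u * Q′ * (n₀ * n₀)         ≡⟨ *-swapʳ (num u) Q′ (n₀ * n₀) ⟩
          x * Q′                         ∎

        deficit : ∃[ s′ ] y + s′ ≡ ζ * Q′
        deficit = m≤n⇒∃[o]m+o≡n (*-cancelʳ-≤ y (ζ * Q′) Q (begin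
          y * Q         ≤⟨ yQ≤xQ′ ⟩
          x * Q′        ≤⟨ *-monoˡ-≤ Q′ (subst (x ≤_) eq (m≤m+n x s)) ⟩
          ζ * Q * Q′    ≡⟨ *-swapʳ ζ Q Q′ ⟩
          ζ * Q′ * Q    ∎))

        s′ : ℕ
        s′ = proj₁ deficit

        -- Passing from `u` down to `w` can only enlarge the distance to `ζ`, which was
        -- `s / Q ≥ 1 / Q`. Hence `k = Q + 1` is already too large.
        Q′≤s′Q : Q′ ≤ s′ * Q
        Q′≤s′Q = begin
          Q′       ≤⟨ m≤n*m Q′ s ⟩
          s * Q′   ≤⟨ +-cancelˡ-≤ (x * Q′) (s * Q′) (s′ * Q) sum ⟩
          s′ * Q   ∎
          where
          sum : x * Q′ + s * Q′ ≤ x * Q′ + s′ * Q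
          sum = begin
            x * Q′ + s * Q′   ≡⟨ *-distribʳ-+ Q′ x s ⟨
            (x + s) * Q′      ≡⟨ cong (_* Q′) eq ⟩
            ζ * Q * Q′        ≡⟨ *-swapʳ ζ Q Q′ ⟩
            ζ * Q′ * Q        ≡⟨ cong (_* Q) (proj₂ deficit) ⟨
            (y + s′) * Q      ≡⟨ *-distribʳ-+ Q y s′ ⟩
            y * Q + s′ * Q    ≤⟨ +-monoˡ-≤ (s′ * Q) yQ≤xQ′ ⟩
            x * Q′ + s′ * Q   ∎

        scale : ∀ {p a d b Q} → p * (a * a) + d ≡ b * Q → ∀ k →
                p * (k * a * (k * a)) + k * k * d ≡ k * k * b * Q
        scale {p} {a} {d} {b} {Q} eq k =
          trans (expand p a d k) (trans (cong (k * k *_) eq) (sym (*-assoc (k * k) b Q)))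
          where
          expand : ∀ p a d k → p * (k * a * (k * a)) + k * k * d ≡ k * k * (p * (a * a) + d)
          expand = solve-∀

        -- The floor of `u (h n₀)²` is at least `h²ζ - 1`, and sharpness of `u` at `h n₀` passes
        -- this on to `w`. So `h²s′ ≤ Q′`, and the search for `k` can start at `h`.
        hhζ≤floor : h * h * ζ ≤ suc ⌊ u ⟨ h * n₀ ⟩²⌋
        hhζ≤floor = s≤s⁻¹ (*-cancelʳ-< Q _ _ (begin-strict
          h * h * ζ * Q                                       ≡⟨ scale {num u} {n₀} {s} {ζ} {Q} eq h ⟨
          num u * (h * n₀ * (h * n₀)) + h * h * s             <⟨ +-mono-<-≤ (floor-upper u (h * n₀)) hhs≤Q ⟩
          suc ⌊ u ⟨ h * n₀ ⟩²⌋ * Q + Q                        ≡⟨ +-comm _ Q ⟩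
          suc (suc ⌊ u ⟨ h * n₀ ⟩²⌋) * Q                      ∎))

        hhs′≤Q′ : h * h * s′ ≤ Q′
        hhs′≤Q′ = +-cancelˡ-≤ (num w * (h * n₀ * (h * n₀))) _ _ (begin
          num w * (h * n₀ * (h * n₀)) + h * h * s′            ≡⟨ scale {num w} {n₀} {s′} {ζ} {Q′} (proj₂ deficit) h ⟩
          h * h * ζ * Q′                                      ≤⟨ *-monoˡ-≤ Q′ (≤-trans hhζ≤floor (s≤s (least w Vw (h * n₀) ≤-refl))) ⟩
          Q′ + ⌊ w ⟨ h * n₀ ⟩²⌋ * Q′                          ≤⟨ +-monoʳ-≤ Q′ (floor-lower w (h * n₀)) ⟩
          Q′ + num w * (h * n₀ * (h * n₀))                    ≡⟨ +-comm Q′ _ ⟩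
          num w * (h * n₀ * (h * n₀)) + Q′                    ∎)

        too-large : ¬ suc Q * suc Q * s′ ≤ Q′
        too-large = <⇒≱ (begin-strict
          Q′                    ≤⟨ Q′≤s′Q ⟩
          s′ * Q                <⟨ *-monoʳ-< s′ {{s′≢0}} (n<1+n Q) ⟩
          s′ * suc Q            ≤⟨ *-monoʳ-≤ s′ (m≤m*n (suc Q) (suc Q)) ⟩
          s′ * (suc Q * suc Q)  ≡⟨ *-comm s′ _ ⟩
          suc Q * suc Q * s′    ∎)
          where
          s′≢0 : NonZero s′
          s′≢0 = ≢-nonZero λ s′≡0 → contradiction (subst (λ s → Q′ ≤ s * Q) s′≡0 Q′≤s′Q) λ ()

        largest = last (λ k → k * k * s′ ≤? Q′) (suc Q ∸ h) {h} hhs′≤Q′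
          (subst (λ k → ¬ k * k * s′ ≤ Q′) (sym (m∸n+n≡m (m≤n⇒m≤1+n h≤Q))) too-large)

        k : ℕ
        k = proj₁ largest

        h≤k : h ≤ k
        h≤k = proj₁ (proj₂ largest)

        1≤k : 1 ≤ k
        1≤k = ≤-trans (>-nonZero⁻¹ h) h≤k

        instance
          k≢0 : NonZero k
          k≢0 = >-nonZero 1≤k

        k≤Q : k ≤ Q
        k≤Q = s≤s⁻¹ (subst (k <_) (m∸n+n≡m (m≤n⇒m≤1+n h≤Q)) (proj₁ (proj₂ (proj₂ largest))))

        kks′≤Q′ : k * k * s′ ≤ Q′
        kks′≤Q′ = proj₁ (proj₂ (proj₂ (proj₂ largest)))

        gap : ∃[ ρ ] k * k * s′ + ρ ≡ Q′
        gap = m≤n⇒∃[o]m+o≡n kks′≤Q′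

        ρ : ℕ
        ρ = proj₁ gap

        ρ< : ρ < (2 * k + 1) * s′
        ρ< = +-cancelˡ-< (k * k * s′) _ _ (begin-strict
          k * k * s′ + ρ                       ≡⟨ proj₂ gap ⟩
          Q′                                   <⟨ ≰⇒> (proj₂ (proj₂ (proj₂ (proj₂ largest)))) ⟩
          suc k * suc k * s′                   ≡⟨ square-suc k s′ ⟩
          k * k * s′ + (2 * k + 1) * s′        ∎)
          where
          square-suc : ∀ k s → suc k * suc k * s ≡ k * k * s + (2 * k + 1) * s
          square-suc = solve-∀

        Dρ<Q′ : D * ρ < Q′
        Dρ<Q′ = *-cancelˡ-< 3 _ _ (begin-strict
          3 * (D * ρ)                          ≡⟨ *-assoc 3 D ρ ⟨
          h * ρ                                ≤⟨ *-monoˡ-≤ ρ h≤k ⟩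
          k * ρ                                <⟨ *-monoʳ-< k ρ< ⟩
          k * ((2 * k + 1) * s′)               ≡⟨ expand k s′ ⟩
          2 * (k * k * s′) + k * s′            ≤⟨ +-monoʳ-≤ (2 * (k * k * s′)) (*-monoˡ-≤ s′ (m≤m*n k k)) ⟩
          2 * (k * k * s′) + k * k * s′        ≡⟨ triple (k * k * s′) ⟩
          3 * (k * k * s′)                     ≤⟨ *-monoʳ-≤ 3 kks′≤Q′ ⟩
          3 * Q′                               ∎)
          where
          expand : ∀ k s → k * ((2 * k + 1) * s) ≡ 2 * (k * k * s) + k * s
          expand = solve-∀
          triple : ∀ x → 2 * x + x ≡ 3 * x
          triple = solve-∀

        -- As `0 < k²s′ ≤ Q′`, the number `w (k n₀)²` lies less than or exactly 1 below `k²ζ`; its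
        -- floor is `k²ζ - 1`, with remainder `ρ`.
        predecessor : ∃[ f ] 1 + f ≡ k * k * ζ
        predecessor = m≤n⇒∃[o]m+o≡n (>-nonZero⁻¹ (k * k * ζ) {{m*n≢0 (k * k) ζ {{m*n≢0 k k}} {{>-nonZero 1≤ζ}}}})

        f : ℕ
        f = proj₁ predecessor

        remainder : num w * (k * n₀ * (k * n₀)) ≡ ρ + f * Q′
        remainder = +-cancelʳ-≡ (k * k * s′) _ _ (trans
          (scale {num w} {n₀} {s′} {ζ} {Q′} (proj₂ deficit) k)
          (trans (cong (_* Q′) (sym (proj₂ predecessor)))
          (trans (cong (_+ f * Q′) (sym (proj₂ gap))) (rearrange (k * k * s′) ρ (f * Q′)))))
          where
          rearrange : ∀ a b c → a + b + c ≡ b + c + a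
          rearrange = solve-∀

    -- Recurrence with `β = 0` and `γ = num u` brings `u (2d)²` within `1 / h²` of an integer. From
    -- above, `t = 2d` serves; from below, `overshoot` applies. As `W` does not depend on `u`, one
    -- can first make `u` sharp up to `h * (2 * W)`, the range that `overshoot` needs.
    seed : ∀ D .{{_ : NonZero D}} → ∃ V → ¬ ¬ (∃[ t ] ∃[ w ] Seed D t w)
    seed D (u₀ , Vu₀) none = sharpen (h * (2 * W)) u₀ Vu₀ λ { (u , _ , sharp) → find u sharp }
      where
      h : ℕ
      h = 3 * D

      instance
        h≢0 : NonZero h
        h≢0 = m*n≢0 3 D
        6hh≢0 : NonZero (6 * (h * h))
        6hh≢0 = m*n≢0 6 (h * h) {{_}} {{m*n≢0 h h}}

      W : ℕ
      W = proj₁ (recurrence (6 * (h * h)))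

      find : ∀ u → Sharp (h * (2 * W)) u → ⊥
      find u (Vu , least) with proj₂ (recurrence (6 * (h * h))) (den u) 0 (num u)
      ... | d , 1≤d , d≤W , z , e , eq , e-small = by-sign e eq hh∣e∣≤Q
        where
        n₀≤ : 2 * d ≤ 2 * W
        n₀≤ = *-monoʳ-≤ 2 d≤W

        1≤2d : 1 ≤ 2 * d
        1≤2d = ≤-trans 1≤d (m≤m+n d _)

        hh∣e∣≤Q : h * h * ℤ.∣ e ∣ ≤ den u
        hh∣e∣≤Q = *-cancelˡ-≤ 6 (subst (_≤ 6 * den u) (*-assoc 6 (h * h) ℤ.∣ e ∣) e-small)

        by-sign : ∀ e → ℤ.+ (num u * ((2 * d) * (2 * d))) ≡ z ℤ.* ℤ.+ den u ℤ.+ e → h * h * ℤ.∣ e ∣ ≤ den u → ⊥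
        by-sign (ℤ.+ r) eq hhr≤Q =
          let f , eq′ = natural-quotient {z = z} {r} eq (≤-<-trans (m≤n*m r D) Dr<Q) in
          none (2 * d , u , 1≤2d , small-fraction D u (2 * d) r f eq′ Dr<Q , Vu
               , λ w Vw n n≤2d → least w Vw n (≤-trans n≤2d (≤-trans n₀≤ (m≤n*m (2 * W) h))))
          where
          Dr<Q : D * r < den u
          Dr<Q = by-cases r hhr≤Q
            where
            D<hh : D < h * h
            D<hh = <-≤-trans (subst (D <_) (*-comm D 3) (m<m*n D 3 (s≤s (s≤s z≤n)))) (m≤m*n h h)
            by-cases : ∀ r → h * h * r ≤ den u → D * r < den u
            by-cases zero    _    = subst (_< den u) (sym (*-zeroʳ D)) (s≤s z≤n)
            by-cases (suc r) hhr≤Q = <-≤-trans (*-monoˡ-< (suc r) D<hh) hhr≤Q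
        by-sign -[1+ r ] eq hhs≤Q =
          let ζ , eq′ = natural-quotient⁻ {z = z} {r} eq in
          overshoot D u (2 * d) (suc r) ζ
            (Vu , λ w Vw n n≤ → least w Vw n (≤-trans n≤ (*-monoʳ-≤ h n₀≤)))
            1≤2d (s≤s z≤n) eq′ hhs≤Q none

  -- Density

  coprime-1+multiple : ∀ {d K} i → d ∣ K → Coprime (1 + K * i) d
  coprime-1+multiple {K = K} i d∣K {c} (c∣1+Ki , c∣d) =
    ∣1⇒≡1 (∣m+n∣m⇒∣n (subst (c ∣_) (+-comm 1 (K * i)) c∣1+Ki) (∣m⇒∣m*n i (∣-trans c∣d d∣K)))

  ∣n! : ∀ {d n} → 1 ≤ d → d ≤ n → d ∣ n !
  ∣n! {suc d} _ d≤n = ∣-trans (m∣m*n (d !)) (m≤n⇒m!∣n! d≤n)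

  -- By coprimality each of `m` and `n` divides the other.
  cofactor-unique : ∀ {m n c d} → Coprime m d → Coprime n c → m * c ≡ n * d → m ≡ n
  cofactor-unique {m} {n} {c} {d} m⊥d n⊥c eq = ∣-antisym
    (coprime-divisor m⊥d (divides c (trans (*-comm d n) (trans (sym eq) (*-comm m c)))))
    (coprime-divisor n⊥c (divides d (trans (*-comm c m) (trans eq (*-comm n d)))))

  shift : ∀ r e → ℤ.∣ e ∣ ≤ r → ∃[ s ] ℤ.+ r ℤ.+ e ≡ ℤ.+ s × s ≤ r + ℤ.∣ e ∣
  shift r (ℤ.+ k)  _  = r + k , refl , ≤-refl
  shift r -[1+ k ] ≤r = r ∸ suc k , ℤ.⊖-≥ ≤r , ≤-trans (m∸n≤m r (suc k)) (m≤m+n r (suc k))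

  module Density (V : Fraction → Set) where
    open Upper V

    -- Positive lower density as an injective enumeration of linear growth, with `A` and `B` fixed
    -- before `N`, `M` and `u`. The bound `i ≤ ν i` later allows small `n` to be skipped.
    Dense : ℕ → Set
    Dense D = ∃[ A ] ∃[ B ] (∀ N M → ¬ ¬ (∃[ u ] Sharp M u × Σ[ ν ∈ (ℕ → ℕ) ]
        (∀ i → i ≤ N → i ≤ ν i × ν i ≤ A + B * i × SmallFraction D u (ν i))
      × (∀ i j → ν i ≡ ν j → i ≡ j)))

    -- The hypotheses express `f ≤ αt² < w t² < f + 1/D`.
    module _ (D : ℕ) .{{_ : NonZero D}} (t : ℕ) (w : Fraction) (Vw : V w) (1≤t : 1 ≤ t)
             (r₁ f : ℕ) (eq₁ : num w * (t * t) ≡ r₁ + f * den w) (Dr₁<Qw : D * r₁ < den w)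
             (f≤ : ∀ u → V u → f * den u ≤ num u * (t * t)) where

      excess : ∀ u → V u → ∃[ r ] num u * (t * t) ≡ r + f * den u
      excess u Vu = let r , eq = m≤n⇒∃[o]m+o≡n (f≤ u Vu) in
                    r , trans (sym eq) (+-comm (f * den u) r)

      -- As `α` is the infimum of `V`, this means `αt² ≥ f + 1/g` for `g > 0`.
      Margin : ℕ → Set
      Margin g = ∀ u → V u → (1 + g * f) * den u ≤ g * (num u * (t * t))

      -- Without a margin, αt² is the integer f.
      dense-integral : ¬ ∃ Margin → Dense D
      dense-integral ¬margin = 0 , t , λ N M none →
        -- Failure of this margin gives a `u` with `u t² < f + 1/g` for `g = DN² + 1`. The
        -- fractional part at `t * i` is then below `i² / g < 1 / D` for all `i ≤ N`.
        ¬margin (suc (D * (N * N)) , λ u Vu → ≮⇒≥ λ close → sharpen M u Vu λ { (v , v⊑u , sharp@(Vv , _)) →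
          none (v , sharp , (λ i → t * i)
               , (λ i i≤N → m≤n*m i t , ≤-refl , small N u close v v⊑u Vv i i≤N)
               , λ i j → *-cancelˡ-≡ i j t) })
        where
        instance
          t≢0 : NonZero t
          t≢0 = >-nonZero 1≤t

        small : ∀ N u → suc (D * (N * N)) * (num u * (t * t)) < (1 + suc (D * (N * N)) * f) * den u →
                ∀ v → v ⊑ u → V v → ∀ i → i ≤ N → SmallFraction D v (t * i)
        small N u close v v⊑u Vv i i≤N =
          small-fraction D v (t * i) (i * i * r) (i * i * f) multiple (begin-strict
            D * (i * i * r)    ≡⟨ *-assoc D (i * i) r ⟨
            D * (i * i) * r    ≤⟨ *-monoˡ-≤ r (≤-trans (*-monoʳ-≤ D (*-mono-≤ i≤N i≤N)) (n≤1+n _)) ⟩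
            g * r              <⟨ gr<Q ⟩
            den v              ∎)
          where
          open ≤-Reasoning
          g r : ℕ
          g = suc (D * (N * N))
          r = proj₁ (excess v Vv)

          close′ : g * (num v * (t * t)) < (1 + g * f) * den v
          close′ = *-cancelʳ-< (den u) _ _ (begin-strict
            g * (num v * (t * t)) * den u    ≡⟨ pull g (num v) (t * t) (den u) ⟩
            g * (t * t) * (num v * den u)    ≤⟨ *-monoʳ-≤ (g * (t * t)) v⊑u ⟩
            g * (t * t) * (num u * den v)    ≡⟨ pull g (num u) (t * t) (den v) ⟨
            g * (num u * (t * t)) * den v    <⟨ *-monoˡ-< (den v) close ⟩
            (1 + g * f) * den u * den v      ≡⟨ *-swapʳ (1 + g * f) (den u) (den v) ⟩
            (1 + g * f) * den v * den u      ∎)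
            where
            pull : ∀ g a b c → g * (a * b) * c ≡ g * b * (a * c)
            pull = solve-∀

          gr<Q : g * r < den v
          gr<Q = +-cancelʳ-< (g * f * den v) _ _ (begin-strict
            g * r + g * f * den v            ≡⟨ *-distrib-divMod g r f (den v) ⟨
            g * (r + f * den v)              ≡⟨ cong (g *_) (proj₂ (excess v Vv)) ⟨
            g * (num v * (t * t))            <⟨ close′ ⟩
            den v + g * f * den v            ∎)

          multiple : num v * (t * i * (t * i)) ≡ i * i * r + i * i * f * den v
          multiple = trans (pull (num v) t i) (trans (cong (i * i *_) (proj₂ (excess v Vv)))
                       (*-distrib-divMod (i * i) r f (den v)))
            where
            pull : ∀ p t i → p * (t * i * (t * i)) ≡ i * i * (p * (t * t))
            pull = solve-∀

      -- Here αt² lies strictly between f and f + 1/D, so for n = t + 2md the fractional part of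
      -- αn² stays below 1/D whenever both 4αtmd and 4αm²d² are close enough to integers.
      -- The factors m = 1 + W!·i are coprime to every d ≤ W, which makes n injective in i.
      dense-margin : ∀ g .{{_ : NonZero g}} → Margin g → Dense D
      dense-margin g margin = t + 2 * W , 2 * W * W ! , λ N M none →
        sharpen M w Vw λ { (u , u⊑w , sharp@(Vu , _)) → none
          (u , sharp , ν u , (λ i _ → i≤ν u i , ν≤ u i , small u i u⊑w Vu) , ν-injective u) }
        where
        h : ℕ
        -- The factor `g` keeps the error below the margin, so that `r + e` is not negative. The
        -- factor `2 * (D * den w)` keeps it below the gap between `r₁ / den w` and `1 / D`, which
        -- is at least `1 / (D * den w)`.
        h = 2 * (g * (D * den w))

        instance
          Dw≢0 : NonZero (D * den w)
          Dw≢0 = m*n≢0 D (den w)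
          gDw≢0 : NonZero (g * (D * den w))
          gDw≢0 = m*n≢0 g (D * den w)
          h≢0 : NonZero h
          h≢0 = m*n≢0 2 (g * (D * den w))
          6h≢0 : NonZero (6 * h)
          6h≢0 = m*n≢0 6 h

        W : ℕ
        W = proj₁ (recurrence (6 * h))

        m : ℕ → ℕ
        m i = 1 + W ! * i

        module _ (u : Fraction) (i : ℕ) where
          -- The coefficients are those of `2d` and `(2d)²` in `u (t + m · 2d)²`.
          return = proj₂ (recurrence (6 * h)) (den u) (num u * (2 * t * m i)) (num u * (m i * m i))

          d : ℕ
          d = proj₁ return

          1≤d : 1 ≤ d
          1≤d = proj₁ (proj₂ return)

          d≤W : d ≤ W
          d≤W = proj₁ (proj₂ (proj₂ return))

          ν : ℕ
          ν = t + m i * (2 * d)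

          i≤ν : i ≤ ν
          i≤ν = begin
            i               ≤⟨ m≤n*m i (W !) {{W !≢0}} ⟩
            W ! * i         ≤⟨ n≤1+n _ ⟩
            m i             ≤⟨ m≤m*n (m i) (2 * d) {{m*n≢0 2 d {{_}} {{>-nonZero 1≤d}}}} ⟩
            m i * (2 * d)   ≤⟨ m≤n+m _ t ⟩
            ν               ∎
            where open ≤-Reasoning

          ν≤ : ν ≤ t + 2 * W + 2 * W * W ! * i
          ν≤ = begin
            t + m i * (2 * d)              ≤⟨ +-monoʳ-≤ t (*-monoʳ-≤ (m i) (*-monoʳ-≤ 2 d≤W)) ⟩
            t + (1 + W ! * i) * (2 * W)    ≡⟨ expand t W (W !) i ⟩
            t + 2 * W + 2 * W * W ! * i    ∎
            where
            open ≤-Reasoning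
            expand : ∀ t W K i → t + (1 + K * i) * (2 * W) ≡ t + 2 * W + 2 * W * K * i
            expand = solve-∀

          small : u ⊑ w → V u → SmallFraction D u ν
          small u⊑w Vu =
            let s , r+e≡s , s≤r+∣e∣ = shift r e ∣e∣≤r
                Ds<Q = ≤-<-trans (*-monoʳ-≤ D s≤r+∣e∣) D[r+∣e∣]<Q
                f′ , eq = natural-quotient {z = ℤ.+ f ℤ.+ z} {s} (trans square (cong (λ s → (ℤ.+ f ℤ.+ z) ℤ.* ℤ.+ Q ℤ.+ s) r+e≡s))
                            (≤-<-trans (m≤n*m s D) Ds<Q)
            in small-fraction D u ν s f′ eq Ds<Q
            where
            open ≤-Reasoning
            Q r : ℕ
            Q = den u
            r = proj₁ (excess u Vu)

            z e : ℤ
            z = proj₁ (proj₂ (proj₂ (proj₂ return)))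
            e = proj₁ (proj₂ (proj₂ (proj₂ (proj₂ return))))

            h∣e∣≤Q : h * ℤ.∣ e ∣ ≤ Q
            h∣e∣≤Q = *-cancelˡ-≤ 6 (subst (_≤ 6 * Q) (*-assoc 6 h ℤ.∣ e ∣)
              (proj₂ (proj₂ (proj₂ (proj₂ (proj₂ (proj₂ return)))))))

            square : ℤ.+ (num u * (ν * ν)) ≡ (ℤ.+ f ℤ.+ z) ℤ.* ℤ.+ Q ℤ.+ (ℤ.+ r ℤ.+ e)
            square = trans (cong ℤ.+_ (expand (num u) t (m i) d))
              (trans (cong₂ ℤ._+_ (trans (cong ℤ.+_ (proj₂ (excess u Vu))) (cong (λ x → ℤ.+ r ℤ.+ x) (ℤ.pos-* f Q)))
                                  (proj₁ (proj₂ (proj₂ (proj₂ (proj₂ (proj₂ return)))))))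
                     (collect (ℤ.+ r) (ℤ.+ f) (ℤ.+ Q) z e))
              where
              expand : ∀ p t m d → p * ((t + m * (2 * d)) * (t + m * (2 * d)))
                ≡ p * (t * t) + (p * (2 * t * m) * (2 * d) + p * (m * m) * ((2 * d) * (2 * d)))
              expand = solve-∀
              collect : ∀ r f Q z e → (r ℤ.+ f ℤ.* Q) ℤ.+ (z ℤ.* Q ℤ.+ e) ≡ (f ℤ.+ z) ℤ.* Q ℤ.+ (r ℤ.+ e)
              collect = ℤ-solver.solve-∀

            Q≤gr : Q ≤ g * r
            Q≤gr = +-cancelʳ-≤ (g * f * Q) _ _ (begin
              Q + g * f * Q              ≤⟨ margin u Vu ⟩
              g * (num u * (t * t))      ≡⟨ cong (g *_) (proj₂ (excess u Vu)) ⟩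
              g * (r + f * Q)            ≡⟨ *-distrib-divMod g r f Q ⟩
              g * r + g * f * Q          ∎)

            g≤h : g ≤ h
            g≤h = ≤-trans (m≤m*n g (D * den w)) (m≤n*m (g * (D * den w)) 2)

            ∣e∣≤r : ℤ.∣ e ∣ ≤ r
            ∣e∣≤r = *-cancelˡ-≤ g (≤-trans (*-monoˡ-≤ ℤ.∣ e ∣ g≤h) (≤-trans h∣e∣≤Q Q≤gr))

            rQw≤r₁Q : r * den w ≤ r₁ * Q
            rQw≤r₁Q = +-cancelʳ-≤ (f * Q * den w) _ _ (begin
              r * den w + f * Q * den w       ≡⟨ *-distribʳ-+ (den w) r (f * Q) ⟨
              (r + f * Q) * den w             ≡⟨ cong (_* den w) (proj₂ (excess u Vu)) ⟨
              num u * (t * t) * den w         ≡⟨ *-swapʳ (num u) (t * t) (den w) ⟩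
              num u * den w * (t * t)         ≤⟨ *-monoˡ-≤ (t * t) u⊑w ⟩
              num w * Q * (t * t)             ≡⟨ *-swapʳ (num w) Q (t * t) ⟩
              num w * (t * t) * Q             ≡⟨ cong (_* Q) eq₁ ⟩
              (r₁ + f * den w) * Q            ≡⟨ distribute r₁ f (den w) Q ⟩
              r₁ * Q + f * Q * den w          ∎)
              where
              distribute : ∀ r f P Q → (r + f * P) * Q ≡ r * Q + f * Q * P
              distribute = solve-∀

            Dw∣e∣<Q : D * den w * ℤ.∣ e ∣ < Q
            Dw∣e∣<Q = *-cancelˡ-< 2 _ _ (begin-strict
              2 * (D * den w * ℤ.∣ e ∣)         ≡⟨ *-assoc 2 (D * den w) ℤ.∣ e ∣ ⟨
              2 * (D * den w) * ℤ.∣ e ∣         ≤⟨ *-monoˡ-≤ ℤ.∣ e ∣ (*-monoʳ-≤ 2 (m≤n*m (D * den w) g)) ⟩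
              h * ℤ.∣ e ∣                       ≤⟨ h∣e∣≤Q ⟩
              Q                                 <⟨ m<m+n Q (s≤s z≤n) ⟩
              2 * Q                             ∎)

            D[r+∣e∣]<Q : D * (r + ℤ.∣ e ∣) < Q
            D[r+∣e∣]<Q = *-cancelʳ-< (den w) _ _ (begin-strict
              D * (r + ℤ.∣ e ∣) * den w                     ≡⟨ expand D r ℤ.∣ e ∣ (den w) ⟩
              D * (r * den w) + D * den w * ℤ.∣ e ∣         <⟨ +-mono-≤-< (*-monoʳ-≤ D rQw≤r₁Q) Dw∣e∣<Q ⟩
              D * (r₁ * Q) + Q                              ≡⟨ collect D r₁ Q ⟩
              suc (D * r₁) * Q                              ≤⟨ *-monoˡ-≤ Q Dr₁<Qw ⟩
              den w * Q                                     ≡⟨ *-comm (den w) Q ⟩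
              Q * den w                                     ∎)
              where
              expand : ∀ D r e P → D * (r + e) * P ≡ D * (r * P) + D * P * e
              expand = solve-∀
              collect : ∀ D r Q → D * (r * Q) + Q ≡ suc (D * r) * Q
              collect = solve-∀

        ν-injective : ∀ u i j → ν u i ≡ ν u j → i ≡ j
        ν-injective u i j eq = *-cancelˡ-≡ i j (W !) {{W !≢0}} (suc-injective
          (cofactor-unique (coprime i j) (coprime j i)
            (*-cancelˡ-≡ _ _ 2 (trans (double (m i) (d u i)) (trans (+-cancelˡ-≡ t _ _ eq) (sym (double (m j) (d u j))))))))
          where
          coprime : ∀ i j → Coprime (m i) (d u j)
          coprime i j = coprime-1+multiple i (∣n! (1≤d u j) (d≤W u j))
          double : ∀ m d → 2 * (m * d) ≡ m * (2 * d)
          double = solve-∀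

    -- Either case refutes `none`: a margin would do so by `dense-margin`, hence there is none and
    -- `dense-integral` applies. `Margin 0` is impossible, since denominators are positive.
    dense : ∀ D .{{_ : NonZero D}} → ∃ V → ¬ ¬ Dense D
    dense D inhabited none = seed D inhabited λ { (t , w , 1≤t , (r , eq , Dr<Q) , (Vw , least)) →
      let f≤ : ∀ u → V u → ⌊ w ⟨ t ⟩²⌋ * den u ≤ num u * (t * t)
          f≤ u Vu = ≤-trans (*-monoˡ-≤ (den u) (least u Vu t ≤-refl)) (floor-lower u t)
      in none (dense-integral D t w Vw 1≤t r ⌊ w ⟨ t ⟩²⌋ eq Dr<Q f≤ λ
        { (zero  , margin) → contradiction (margin w Vw) λ ()
        ; (suc g , margin) → none (dense-margin D t w Vw 1≤t r ⌊ w ⟨ t ⟩²⌋ eq Dr<Q f≤ (suc g) margin) }) }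

  -- Bricks

  n^2≡n*n : ∀ n → n ^ 2 ≡ n * n
  n^2≡n*n n = cong (n *_) (*-identityʳ n)

  square-cancel-≤ : ∀ {m n} → m * m ≤ n * n → m ≤ n
  square-cancel-≤ mm≤nn = ≮⇒≥ λ n<m → <⇒≱ (*-mono-< n<m n<m) mm≤nn

  floor-monoʳ : ∀ u {m n} → m ≤ n → ⌊ u ⟨ m ⟩²⌋ ≤ ⌊ u ⟨ n ⟩²⌋
  floor-monoʳ u {m} {n} m≤n = floor-greatest u n _
    (≤-trans (floor-lower u m) (*-monoʳ-≤ (num u) (*-mono-≤ m≤n m≤n)))

  -- The values differ by at least 1, since `u n² - u m² ≥ u m ≥ u q ≥ 1`.
  floor-monoʳ-< : ∀ u {q m n} → den u ≤ num u * q → q ≤ m → m < n → ⌊ u ⟨ m ⟩²⌋ < ⌊ u ⟨ n ⟩²⌋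
  floor-monoʳ-< u {q} {m} {n} 1≤uq q≤m m<n = floor-greatest u n _ (begin
    den u + ⌊ u ⟨ m ⟩²⌋ * den u            ≤⟨ +-mono-≤ (≤-trans 1≤uq (*-monoʳ-≤ (num u) q≤m)) (floor-lower u m) ⟩
    num u * m + num u * (m * m)            ≡⟨ *-distribˡ-+ (num u) m (m * m) ⟨
    num u * (suc m * m)                    ≤⟨ *-monoʳ-≤ (num u) (*-mono-≤ m<n (<⇒≤ m<n)) ⟩
    num u * (n * n)                        ∎)
    where open ≤-Reasoning

  floor-injective : ∀ u {q m n} → den u ≤ num u * q → q ≤ m → q ≤ n → ⌊ u ⟨ m ⟩²⌋ ≡ ⌊ u ⟨ n ⟩²⌋ → m ≡ n
  floor-injective u {q} {m} {n} 1≤uq q≤m q≤n eq with <-cmp m n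
  ... | tri< m<n _ _ = contradiction eq (<⇒≢ (floor-monoʳ-< u 1≤uq q≤m m<n))
  ... | tri≈ _ m≡n _ = m≡n
  ... | tri> _ _ n<m = contradiction (sym eq) (<⇒≢ (floor-monoʳ-< u 1≤uq q≤n n<m))

  floor-positive : ∀ u {q n} → den u ≤ num u * q → 1 ≤ n → q ≤ n → 1 ≤ ⌊ u ⟨ n ⟩²⌋
  floor-positive u {q} {n} 1≤uq 1≤n q≤n = floor-greatest u n 1 (begin
    1 * den u          ≡⟨ *-identityˡ (den u) ⟩
    den u              ≤⟨ 1≤uq ⟩
    num u * q          ≤⟨ *-monoʳ-≤ (num u) (≤-trans q≤n (m≤m*n n n {{>-nonZero 1≤n}})) ⟩
    num u * (n * n)    ∎)
    where open ≤-Reasoning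

  -- Multiplied by `e² ≤ D`, the remainder still stays below the denominator.
  floor-multiple : ∀ D u n e → SmallFraction D u n → e * e ≤ D → ⌊ u ⟨ n * e ⟩²⌋ ≡ e * e * ⌊ u ⟨ n ⟩²⌋
  floor-multiple D u n e (r , eq , Dr<Q) ee≤D = floor-unique u (n * e) (e * e * r) (e * e * ⌊ u ⟨ n ⟩²⌋)
    (trans (pull (num u) n e) (trans (cong (e * e *_) eq) (*-distrib-divMod (e * e) r ⌊ u ⟨ n ⟩²⌋ (den u))))
    (≤-<-trans (*-monoˡ-≤ r ee≤D) Dr<Q)
    where
    pull : ∀ p n e → p * (n * e * (n * e)) ≡ e * e * (p * (n * n))
    pull = solve-∀

  floor-pythagorean : ∀ D u n e f g → SmallFraction D u n → e * e + f * f ≡ g * g → g * g ≤ D →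
                      ⌊ u ⟨ n * e ⟩²⌋ + ⌊ u ⟨ n * f ⟩²⌋ ≡ ⌊ u ⟨ n * g ⟩²⌋
  floor-pythagorean D u n e f g small eq gg≤D = begin
    ⌊ u ⟨ n * e ⟩²⌋ + ⌊ u ⟨ n * f ⟩²⌋                ≡⟨ cong₂ _+_
        (floor-multiple D u n e small (≤-trans (subst (e * e ≤_) eq (m≤m+n _ _)) gg≤D))
        (floor-multiple D u n f small (≤-trans (subst (f * f ≤_) eq (m≤n+m _ _)) gg≤D)) ⟩
    e * e * ⌊ u ⟨ n ⟩²⌋ + f * f * ⌊ u ⟨ n ⟩²⌋        ≡⟨ *-distribʳ-+ ⌊ u ⟨ n ⟩²⌋ (e * e) (f * f) ⟨
    (e * e + f * f) * ⌊ u ⟨ n ⟩²⌋                    ≡⟨ cong (_* ⌊ u ⟨ n ⟩²⌋) eq ⟩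
    g * g * ⌊ u ⟨ n ⟩²⌋                              ≡⟨ floor-multiple D u n g small gg≤D ⟨
    ⌊ u ⟨ n * g ⟩²⌋                                  ∎
    where open ≡-Reasoning

  -- The order of the edges gives `k ≤ ℓ ≤ m` in `T`. The space diagonal is written as a sum of two
  -- squares, so that `floor-pythagorean` covers it as well.
  record SortedBrick : Set where
    field
      a b c dab dbc dca d : ℕ
      1≤a : 1 ≤ a
      a≤b : a ≤ b
      b≤c : b ≤ c
      face-ab : a * a + b * b ≡ dab * dab
      face-bc : b * b + c * c ≡ dbc * dbc
      face-ca : c * c + a * a ≡ dca * dca
      space   : dab * dab + c * c ≡ d * d

    dab≤ : dab * dab ≤ d * d
    dab≤ = subst (dab * dab ≤_) space (m≤m+n _ _)

    dbc≤ : dbc * dbc ≤ d * d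
    dbc≤ = begin
      dbc * dbc              ≡⟨ face-bc ⟨
      b * b + c * c          ≤⟨ +-monoˡ-≤ (c * c) (m≤n+m (b * b) (a * a)) ⟩
      a * a + b * b + c * c  ≡⟨ cong (_+ c * c) face-ab ⟩
      dab * dab + c * c      ≡⟨ space ⟩
      d * d                  ∎
      where open ≤-Reasoning

    dca≤ : dca * dca ≤ d * d
    dca≤ = begin
      dca * dca              ≡⟨ face-ca ⟨
      c * c + a * a          ≡⟨ +-comm (c * c) (a * a) ⟩
      a * a + c * c          ≤⟨ +-monoˡ-≤ (c * c) (m≤m+n (a * a) (b * b)) ⟩
      a * a + b * b + c * c  ≡⟨ cong (_+ c * c) face-ab ⟩
      dab * dab + c * c      ≡⟨ space ⟩
      d * d                  ∎
      where open ≤-Reasoning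

    c≤d : c ≤ d
    c≤d = square-cancel-≤ (subst (c * c ≤_) space (m≤n+m _ _))

    1≤d : 1 ≤ d
    1≤d = ≤-trans 1≤a (≤-trans a≤b (≤-trans b≤c c≤d))

  sort : PerfectEulerBrick → SortedBrick
  sort brick = by-order (≤-total a b) (≤-total b c) (≤-total a c)
    where
    open PerfectEulerBrick brick

    square : ∀ m n p → m ^ 2 + n ^ 2 ≡ p ^ 2 → m * m + n * n ≡ p * p
    square m n p eq = trans (sym (cong₂ _+_ (n^2≡n*n m) (n^2≡n*n n))) (trans eq (n^2≡n*n p))

    flip : ∀ m n {p} → m * m + n * n ≡ p → n * n + m * m ≡ p
    flip m n eq = trans (+-comm (n * n) (m * m)) eq

    ab = square a b dab face-ab
    bc = square b c dbc face-bc
    ca = square c a dca face-ca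

    abc : a * a + b * b + c * c ≡ d * d
    abc = trans (sym (cong₂ _+_ (cong₂ _+_ (n^2≡n*n a) (n^2≡n*n b)) (n^2≡n*n c))) (trans space (n^2≡n*n d))

    sorted : ∀ x y z p q r → 1 ≤ x → x ≤ y → y ≤ z → x * x + y * y ≡ p * p → y * y + z * z ≡ q * q →
             z * z + x * x ≡ r * r → x * x + y * y + z * z ≡ a * a + b * b + c * c → SortedBrick
    sorted x y z p q r 1≤x x≤y y≤z xy yz zx sum = record
      { a = x ; b = y ; c = z ; dab = p ; dbc = q ; dca = r ; d = d
      ; 1≤a = 1≤x ; a≤b = x≤y ; b≤c = y≤z ; face-ab = xy ; face-bc = yz ; face-ca = zx
      ; space = trans (cong (_+ z * z) (sym xy)) (trans sum abc) }

    by-order : a ≤ b ⊎ b ≤ a → b ≤ c ⊎ c ≤ b → a ≤ c ⊎ c ≤ a → SortedBrick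
    by-order (inj₁ a≤b) (inj₁ b≤c) _          = sorted a b c dab dbc dca a≥1 a≤b b≤c ab bc ca refl
    by-order (inj₁ a≤b) (inj₂ c≤b) (inj₁ a≤c) = sorted a c b dca dbc dab a≥1 a≤c c≤b (flip c a ca) (flip b c bc) (flip a b ab)
      (permute a b c)
      where
      permute : ∀ a b c → a * a + c * c + b * b ≡ a * a + b * b + c * c
      permute = solve-∀
    by-order (inj₁ a≤b) (inj₂ c≤b) (inj₂ c≤a) = sorted c a b dca dab dbc c≥1 c≤a a≤b ca ab bc (permute a b c)
      where
      permute : ∀ a b c → c * c + a * a + b * b ≡ a * a + b * b + c * c
      permute = solve-∀
    by-order (inj₂ b≤a) (inj₁ b≤c) (inj₁ a≤c) = sorted b a c dab dca dbc b≥1 b≤a a≤c (flip a b ab) (flip c a ca) (flip b c bc)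
      (permute a b c)
      where
      permute : ∀ a b c → b * b + a * a + c * c ≡ a * a + b * b + c * c
      permute = solve-∀
    by-order (inj₂ b≤a) (inj₁ b≤c) (inj₂ c≤a) = sorted b c a dbc dca dab b≥1 b≤c c≤a bc ca ab (permute a b c)
      where
      permute : ∀ a b c → b * b + c * c + a * a ≡ a * a + b * b + c * c
      permute = solve-∀
    by-order (inj₂ b≤a) (inj₂ c≤b) _          = sorted c b a dbc dab dca c≥1 c≤b b≤a (flip b c bc) (flip a b ab) (flip c a ca)
      (permute a b c)
      where
      permute : ∀ a b c → c * c + b * b + a * a ≡ a * a + b * b + c * c
      permute = solve-∀

open Arithmetic
open import Defs
open import Data.Fin as Fin using (Fin; toℕ)
import Data.Fin.Properties as Fin
open import Data.Integer as ℤ using (-[1+_])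
import Data.Integer.Properties as ℤ
open import Data.List using (length; lookup)
open import Data.List.Membership.Propositional using (_∈_)
open import Data.List.Relation.Unary.Any using (index)
open import Data.List.Relation.Unary.Any.Properties using (lookup-index)
open import Data.Nat as ℕ using (ℕ; suc)
import Data.Nat.Properties as ℕ
open import Data.Nat.Tactic.RingSolver using (solve-∀)
open import Data.Product using (Σ-syntax; ∃; ∃-syntax; _×_; _,_; proj₁; proj₂)
open import Data.Rational as ℚ using (ℚ; 0ℚ; 1ℚ)
import Data.Rational.Properties as ℚ
open import Data.Rational.Unnormalised as ℚᵘ using (ℚᵘ; mkℚᵘ; *≡*; *≤*; *<*)
import Data.Rational.Unnormalised.Properties as ℚᵘ
open import Data.Sum using (inj₁; inj₂)
open import Function using (Equivalence)
open import Relation.Binary.PropositionalEquality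
open import Relation.Nullary using (¬_; contradiction; decidable-stable)
open RationalLemmas

-- Fractions as rational numbers

unnormalised : Fraction → ℚᵘ
unnormalised u = mkℚᵘ (ℤ.+ num u) (den-1 u)

value : Fraction → ℚ
value u = ℤ.+ num u ℚ./ den u

toℚᵘ-value : ∀ u → ℚ.toℚᵘ (value u) ℚᵘ.≃ unnormalised u
toℚᵘ-value u = ℚ.toℚᵘ-fromℚᵘ (unnormalised u)

value-mono-≤ : ∀ u w → u ⊑ w → value u ℚ.≤ value w
value-mono-≤ u w u⊑w = ℚ.toℚᵘ-cancel-≤
  (ℚᵘ.≤-respʳ-≃ (ℚᵘ.≃-sym (toℚᵘ-value w)) (ℚᵘ.≤-respˡ-≃ (ℚᵘ.≃-sym (toℚᵘ-value u))
    (*≤* (subst₂ ℤ._≤_ (ℤ.pos-* (num u) (den w)) (ℤ.pos-* (num w) (den u)) (ℤ.+≤+ u⊑w)))))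

value-mono-< : ∀ u w → num u ℕ.* den w ℕ.< num w ℕ.* den u → value u ℚ.< value w
value-mono-< u w u<w = ℚ.toℚᵘ-cancel-<
  (ℚᵘ.<-respʳ-≃ (ℚᵘ.≃-sym (toℚᵘ-value w)) (ℚᵘ.<-respˡ-≃ (ℚᵘ.≃-sym (toℚᵘ-value u))
    (*<* (subst₂ ℤ._<_ (ℤ.pos-* (num u) (den w)) (ℤ.pos-* (num w) (den u)) (ℤ.+<+ u<w)))))

value-scale : ∀ u n → value u ℚ.* fromℕℚ n ≡ value ((num u ℕ.* n) /1+ den-1 u)
value-scale u n = ℚ.toℚᵘ-injective (ℚᵘ.≃-trans (ℚ.toℚᵘ-homo-* (value u) (fromℕℚ n))
  (ℚᵘ.≃-trans (ℚᵘ.*-cong (toℚᵘ-value u) (toℚᵘ-value (n /1+ 0)))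
  (ℚᵘ.≃-trans (*≡* (cong₂ ℤ._*_ (sym (ℤ.pos-* (num u) n)) (cong ℤ.+_ (sym (ℕ.*-identityʳ (den u))))))
              (ℚᵘ.≃-sym (toℚᵘ-value ((num u ℕ.* n) /1+ den-1 u))))))

fraction : ∀ r → 0ℚ ℚ.< r → ∃[ u ] value u ≡ r
fraction r@(ℚ.mkℚ (ℤ.+ n) d-1 _) _ = n /1+ d-1 , ℚ.fromℚᵘ-toℚᵘ r
fraction r@(ℚ.mkℚ -[1+ _ ] _ _) 0<r = contradiction (ℚ.<-trans 0<r (ℚ.negative⁻¹ r)) (ℚ.<-irrefl refl)

scaled-≤ : ∀ u n k → k ℕ.* den u ℕ.≤ num u ℕ.* n → fromℕℚ k ℚ.≤ value u ℚ.* fromℕℚ n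
scaled-≤ u n k k≤un = subst (fromℕℚ k ℚ.≤_) (sym (value-scale u n))
  (value-mono-≤ (k /1+ 0) ((num u ℕ.* n) /1+ den-1 u) (subst (k ℕ.* den u ℕ.≤_) (sym (ℕ.*-identityʳ _)) k≤un))

scaled-< : ∀ u n k → num u ℕ.* n ℕ.< k ℕ.* den u → value u ℚ.* fromℕℚ n ℚ.< fromℕℚ k
scaled-< u n k un<k = subst (ℚ._< fromℕℚ k) (sym (value-scale u n))
  (value-mono-< ((num u ℕ.* n) /1+ den-1 u) (k /1+ 0) (subst (ℕ._< k ℕ.* den u) (sym (ℕ.*-identityʳ _)) un<k))

fromℕℚ-mono-≤ : ∀ {m n} → m ℕ.≤ n → fromℕℚ m ℚ.≤ fromℕℚ n
fromℕℚ-mono-≤ {m} {n} m≤n = value-mono-≤ (m /1+ 0) (n /1+ 0) (ℕ.*-monoˡ-≤ 1 m≤n)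

fromℕ-≤-trans : ∀ {m n} x → m ℕ.≤ n → fromℕ n ≤ x → fromℕ m ≤ x
fromℕ-≤-trans x m≤n n≤x (q , Uq , q<m) = n≤x (q , Uq , ℚ.<-≤-trans q<m (fromℕℚ-mono-≤ m≤n))

L⇒≤ : ∀ n x → L x (fromℕℚ n) → fromℕ n ≤ x
L⇒≤ n x Ln (q , Uq , q<n) = ℝ.disjoint x Ln (ℝ.U-upper x q<n Uq)

-- From the real `α` to the fractions above it

module Bridge (α : ℝ) (0<α : 0ℝ < α) where

  V : Fraction → Set
  V u = U α (value u)

  open Upper V

  q₀ : ℚ
  q₀ = proj₁ 0<α

  0<q₀ : 0ℚ ℚ.< q₀
  0<q₀ = proj₁ (proj₂ 0<α)

  -- Upper bounds of `α` exceed `q₀ > 0`, so each of them is the value of a `Fraction`.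
  U-value : (P : ℚ → Set) → (∀ u → V u → P (value u)) → ∀ {r} → U α r → P r
  U-value P Pu {r} Ur =
    let u , eq = fraction r (ℚ.<-trans 0<q₀ (ℝ.L<U α (proj₂ (proj₂ 0<α)) Ur)) in
    subst P eq (Pu u (subst (U α) (sym eq) Ur))

  inhabited : ∃ V
  inhabited = U-value (λ _ → ∃ V) _,_ (proj₂ (ℝ.U-inhab α))

  -- Every `u` in `V` exceeds `q₀ = v`, and `v · den v = num v ≥ 1`.
  bounded-below : ∃[ q ] (∀ u → V u → den u ℕ.≤ num u ℕ.* q)
  bounded-below = den v , λ u Vu → ℕ.≮⇒≥ λ uq<1 → ℚ.<-irrefl refl (begin-strict
    fromℕℚ 1                      ≤⟨ scaled-≤ v (den v) 1 (ℕ.*-monoˡ-≤ (den v) 1≤num) ⟩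
    value v ℚ.* fromℕℚ (den v)    ≡⟨ cong (ℚ._* fromℕℚ (den v)) v≡q₀ ⟩
    q₀ ℚ.* fromℕℚ (den v)         ≤⟨ *-mono-≤ʳ (0≤fromℕℚ (den v)) (ℚ.<⇒≤ (ℝ.L<U α (proj₂ (proj₂ 0<α)) Vu)) ⟩
    value u ℚ.* fromℕℚ (den v)    <⟨ scaled-< u (den v) 1 (subst (num u ℕ.* den v ℕ.<_) (sym (ℕ.*-identityˡ (den u))) uq<1) ⟩
    fromℕℚ 1                      ∎)
    where
    open ℚ.≤-Reasoning
    v : Fraction
    v = proj₁ (fraction q₀ 0<q₀)
    v≡q₀ : value v ≡ q₀
    v≡q₀ = proj₂ (fraction q₀ 0<q₀)
    1≤num : 1 ℕ.≤ num v
    1≤num = ℕ.n≢0⇒n>0 λ num≡0 → ℚ.<-irrefl refl (ℚ.<-≤-trans (subst (0ℚ ℚ.<_) (sym v≡q₀) 0<q₀)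
      (value-mono-≤ v (0 /1+ 0) (ℕ.≤-reflexive (cong (ℕ._* 1) num≡0))))

  -- By sharpness `⌊ u ⟨ n ⟩²⌋` is at most `w n²` for every `w > α`, hence at most `αn²`; and
  -- `αn² ≤ u n²` bounds it from above.
  sharp-floor : ∀ {M u} n → Sharp M u → n ℕ.≤ M → ⌊ (n ℕ.^ 2) · α ⌋≡ ⌊ u ⟨ n ⟩²⌋
  sharp-floor {M} {u} n (Vu , least) n≤M = subst (λ N → ⌊ N · α ⌋≡ k) (sym (n^2≡n*n n)) (k≤ , <1+k)
    where
    k : ℕ
    k = ⌊ u ⟨ n ⟩²⌋

    k≤ : fromℕ k ≤ (n ℕ.* n) · α
    k≤ (q , (s , s<q , r , Ur , rn²≤s) , q<k) =
      ℚ.<-asym q<k (ℚ.≤-<-trans (ℚ.≤-trans (U-value (λ r → fromℕℚ k ℚ.≤ r ℚ.* fromℕℚ (n ℕ.* n)) k≤wn² Ur) rn²≤s) s<q)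
      where
      k≤wn² : ∀ w → V w → fromℕℚ k ℚ.≤ value w ℚ.* fromℕℚ (n ℕ.* n)
      k≤wn² w Vw = scaled-≤ w (n ℕ.* n) k (ℕ.≤-trans (ℕ.*-monoˡ-≤ (den w) (least w Vw n n≤M)) (floor-lower w n))

    <1+k : (n ℕ.* n) · α < fromℕ (suc k)
    <1+k = let q , un²<q , q<1+k = ℚ.<-dense (scaled-< u (n ℕ.* n) (suc k) (floor-upper u n)) in
           q , (_ , un²<q , value u , Vu , ℚ.≤-refl) , q<1+k

  -- A cut element `r > n` with `r² s ≤ 1` and `s > α` would give `1 ≤ n < r ≤ r s n ≤ r² s ≤ 1`,
  -- because `s n ≥ s q ≥ 1`.
  α^-½≤ : ∀ {q n} → (∀ u → V u → den u ℕ.≤ num u ℕ.* q) → 1 ℕ.≤ n → q ℕ.≤ n → α ^-½[ 0<α ] ≤ fromℕ n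
  α^-½≤ {q} {n} 1≤αq 1≤n q≤n (p , n<p , r , p<r , inj₁ r≤0) =
    ℚ.<-irrefl refl (ℚ.≤-<-trans (0≤fromℕℚ n) (ℚ.<-≤-trans (ℚ.<-trans n<p p<r) r≤0))
  α^-½≤ {q} {n} 1≤αq 1≤n q≤n (p , n<p , r , p<r , inj₂ (s , Us , rrs≤1)) = ℚ.<-irrefl refl (begin-strict
    1ℚ                            ≤⟨ fromℕℚ-mono-≤ 1≤n ⟩
    fromℕℚ n                      <⟨ n<r ⟩
    r                             ≡⟨ ℚ.*-identityʳ r ⟨
    r ℚ.* 1ℚ                      ≤⟨ *-mono-≤ˡ 0≤r (U-value (λ s → 1ℚ ℚ.≤ s ℚ.* fromℕℚ n) 1≤un Us) ⟩
    r ℚ.* (s ℚ.* fromℕℚ n)        ≤⟨ *-mono-≤ˡ 0≤r (*-mono-≤ˡ 0≤s (ℚ.<⇒≤ n<r)) ⟩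
    r ℚ.* (s ℚ.* r)               ≡⟨ cong (r ℚ.*_) (ℚ.*-comm s r) ⟩
    r ℚ.* (r ℚ.* s)               ≡⟨ ℚ.*-assoc r r s ⟨
    r ℚ.* r ℚ.* s                 ≤⟨ rrs≤1 ⟩
    1ℚ                            ∎)
    where
    open ℚ.≤-Reasoning
    n<r : fromℕℚ n ℚ.< r
    n<r = ℚ.<-trans n<p p<r
    0≤r : 0ℚ ℚ.≤ r
    0≤r = ℚ.≤-trans (0≤fromℕℚ n) (ℚ.<⇒≤ n<r)
    0≤s : 0ℚ ℚ.≤ s
    0≤s = ℚ.<⇒≤ (ℚ.<-trans 0<q₀ (ℝ.L<U α (proj₂ (proj₂ 0<α)) Us))
    1≤un : ∀ u → V u → 1ℚ ℚ.≤ value u ℚ.* fromℕℚ n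
    1≤un u Vu = scaled-≤ u n 1 (subst (ℕ._≤ num u ℕ.* n) (sym (ℕ.*-identityˡ (den u)))
      (ℕ.≤-trans (1≤αq u Vu) (ℕ.*-monoʳ-≤ (num u) q≤n)))

-- Counting the tuples that a brick produces

module Counting (α : ℝ) (0<α : 0ℝ < α) (brick : SortedBrick) where
  open Bridge α 0<α
  open Upper V
  open Density V
  open SortedBrick brick

  tuple : Fraction → ℕ → ℕ × ℕ × ℕ
  tuple u n = ⌊ u ⟨ n ℕ.* a ⟩²⌋ , ⌊ u ⟨ n ℕ.* b ⟩²⌋ , ⌊ u ⟨ n ℕ.* c ⟩²⌋

  module _ {q} (1≤αq : ∀ u → V u → den u ℕ.≤ num u ℕ.* q) {R u n}
           (sharp : Sharp R u) (1≤n : 1 ℕ.≤ n) (q≤n : q ℕ.≤ n) (nd≤R : n ℕ.* d ℕ.≤ R)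
           (small : SmallFraction (d ℕ.* d) u n) where

    1≤uq : den u ℕ.≤ num u ℕ.* q
    1≤uq = 1≤αq u (proj₁ sharp)

    module _ {e} (1≤e : 1 ℕ.≤ e) (e≤d : e ℕ.≤ d) where
      1≤ne : 1 ℕ.≤ n ℕ.* e
      1≤ne = ℕ.*-mono-≤ 1≤n 1≤e

      q≤ne : q ℕ.≤ n ℕ.* e
      q≤ne = ℕ.≤-trans q≤n (ℕ.m≤m*n n e {{ℕ.>-nonZero 1≤e}})

      ne≤R : n ℕ.* e ℕ.≤ R
      ne≤R = ℕ.≤-trans (ℕ.*-monoʳ-≤ n e≤d) nd≤R

      floor : ⌊ ((n ℕ.* e) ℕ.^ 2) · α ⌋≡ ⌊ u ⟨ n ℕ.* e ⟩²⌋
      floor = sharp-floor (n ℕ.* e) sharp ne≤R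

      floor∈S : S α 0<α ⌊ u ⟨ n ℕ.* e ⟩²⌋
      floor∈S = n ℕ.* e , 1≤ne , α^-½≤ 1≤αq 1≤ne q≤ne , floor

      in-range : ∀ x → fromℕ R ≤ x → InRange α 0<α x (n ℕ.* e)
      in-range x R≤x = 1≤ne , α^-½≤ 1≤αq 1≤ne q≤ne , fromℕ-≤-trans x ne≤R R≤x

    1≤b : 1 ℕ.≤ b
    1≤b = ℕ.≤-trans 1≤a a≤b
    1≤c : 1 ℕ.≤ c
    1≤c = ℕ.≤-trans 1≤b b≤c
    b≤d : b ℕ.≤ d
    b≤d = ℕ.≤-trans b≤c c≤d
    a≤d : a ℕ.≤ d
    a≤d = ℕ.≤-trans a≤b b≤d

    pythagorean∈S : ∀ e f g → 1 ℕ.≤ e → e ℕ.* e ℕ.+ f ℕ.* f ≡ g ℕ.* g → g ℕ.* g ℕ.≤ d ℕ.* d →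
                    S α 0<α (⌊ u ⟨ n ℕ.* e ⟩²⌋ ℕ.+ ⌊ u ⟨ n ℕ.* f ⟩²⌋)
    pythagorean∈S e f g 1≤e eq gg≤dd = subst (S α 0<α) (sym (floor-pythagorean (d ℕ.* d) u n e f g small eq gg≤dd))
      (floor∈S (ℕ.≤-trans 1≤e (square-cancel-≤ (subst (e ℕ.* e ℕ.≤_) eq (ℕ.m≤m+n _ _)))) (square-cancel-≤ gg≤dd))

    tuple∈T : Tα α 0<α (tuple u n)
    tuple∈T = record
      { k≥1 = floor-positive u 1≤uq (1≤ne 1≤a a≤d) (q≤ne 1≤a a≤d)
      ; k≤ℓ = floor-monoʳ u (ℕ.*-monoʳ-≤ n a≤b)
      ; ℓ≤m = floor-monoʳ u (ℕ.*-monoʳ-≤ n b≤c)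
      ; k∈ = floor∈S 1≤a a≤d
      ; ℓ∈ = floor∈S 1≤b b≤d
      ; m∈ = floor∈S 1≤c c≤d
      ; k+ℓ∈ = pythagorean∈S a b dab 1≤a face-ab dab≤
      ; ℓ+m∈ = pythagorean∈S b c dbc 1≤b face-bc dbc≤
      ; m+k∈ = pythagorean∈S c a dca 1≤c face-ca dca≤
      -- First the edges `a`, `b` are merged into `dab`, then `dab`, `c` into `d`.
      ; k+ℓ+m∈ = subst (λ k → S α 0<α (k ℕ.+ ⌊ u ⟨ n ℕ.* c ⟩²⌋))
          (sym (floor-pythagorean (d ℕ.* d) u n a b dab small face-ab dab≤))
          (pythagorean∈S dab c d 1≤dab space ℕ.≤-refl)
      }
      where
      1≤dab : 1 ℕ.≤ dab
      1≤dab = ℕ.≤-trans 1≤a (square-cancel-≤ (subst (a ℕ.* a ℕ.≤_) face-ab (ℕ.m≤m+n _ _)))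

    tuple∈T≤ : ∀ x → fromℕ R ≤ x → T≤ α 0<α x (tuple u n)
    tuple∈T≤ x R≤x = tuple∈T , n ℕ.* a , n ℕ.* b , n ℕ.* c
      , in-range 1≤a a≤d x R≤x , in-range 1≤b b≤d x R≤x , in-range 1≤c c≤d x R≤x
      , floor 1≤a a≤d , floor 1≤b b≤d , floor 1≤c c≤d

  -- The indices `q`, ..., `q + N - 1` yield `N` different tuples within range `E (N + 1)`. Stated
  -- for any list containing them, the bound serves both the liminf and the finite case; being
  -- decidable, it escapes the double negation.
  count : Dense (d ℕ.* d) → ∃[ E ] (∀ N xs →
    (∀ t → (∀ x → fromℕ (E ℕ.* suc N) ≤ x → T≤ α 0<α x t) → t ∈ xs) → N ℕ.≤ length xs)
  count (A , B , family) = E , λ N xs contains → decidable-stable (N ℕ.≤? length xs) λ N≰ →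
    family (q ℕ.+ N) (E ℕ.* suc N) λ { (u , sharp , ν , spec , ν-injective) →
      N≰ (bound N xs contains u sharp ν spec ν-injective) }
    where
    q E : ℕ
    -- The successor ensures `q ≥ 1`, hence `n ≥ 1`. `E` is chosen so that
    -- `(A + B(q + N)) d ≤ E (N + 1)`.
    q = suc (proj₁ bounded-below)
    E = (A ℕ.+ B ℕ.* q ℕ.+ B) ℕ.* d

    1≤αq : ∀ u → V u → den u ℕ.≤ num u ℕ.* q
    1≤αq u Vu = ℕ.≤-trans (proj₂ bounded-below u Vu) (ℕ.*-monoʳ-≤ (num u) (ℕ.n≤1+n _))

    bound : ∀ N xs → (∀ t → (∀ x → fromℕ (E ℕ.* suc N) ≤ x → T≤ α 0<α x t) → t ∈ xs) →
      ∀ u → Sharp (E ℕ.* suc N) u → (ν : ℕ → ℕ) →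
      (∀ i → i ℕ.≤ q ℕ.+ N → i ℕ.≤ ν i × ν i ℕ.≤ A ℕ.+ B ℕ.* i × SmallFraction (d ℕ.* d) u (ν i)) →
      (∀ i j → ν i ≡ ν j → i ≡ j) → N ℕ.≤ length xs
    bound N xs contains u sharp ν spec ν-injective = Fin.injective⇒≤ {f = position} position-injective
      where
      module _ (j : Fin N) where
        i n : ℕ
        i = q ℕ.+ toℕ j
        n = ν i

        i≤ : i ℕ.≤ q ℕ.+ N
        i≤ = ℕ.+-monoʳ-≤ q (ℕ.<⇒≤ (Fin.toℕ<n j))

        q≤n : q ℕ.≤ n
        q≤n = ℕ.≤-trans (ℕ.m≤m+n q (toℕ j)) (proj₁ (spec i i≤))

        nd≤R : n ℕ.* d ℕ.≤ E ℕ.* suc N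
        nd≤R = begin
          n ℕ.* d                                                  ≤⟨ ℕ.*-monoˡ-≤ d (proj₁ (proj₂ (spec i i≤))) ⟩
          (A ℕ.+ B ℕ.* i) ℕ.* d                                    ≤⟨ ℕ.*-monoˡ-≤ d (ℕ.+-monoʳ-≤ A (ℕ.*-monoʳ-≤ B i≤)) ⟩
          (A ℕ.+ B ℕ.* (q ℕ.+ N)) ℕ.* d                            ≤⟨ ℕ.m≤m+n _ _ ⟩
          (A ℕ.+ B ℕ.* (q ℕ.+ N)) ℕ.* d ℕ.+ (B ℕ.+ (A ℕ.+ B ℕ.* q) ℕ.* N) ℕ.* d ≡⟨ expand A B q d N ⟩
          E ℕ.* suc N                                              ∎
          where
          open ℕ.≤-Reasoning
          expand : ∀ A B q d N → (A ℕ.+ B ℕ.* (q ℕ.+ N)) ℕ.* d ℕ.+ (B ℕ.+ (A ℕ.+ B ℕ.* q) ℕ.* N) ℕ.* d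
                   ≡ (A ℕ.+ B ℕ.* q ℕ.+ B) ℕ.* d ℕ.* suc N
          expand = solve-∀

        member : tuple u n ∈ xs
        member = contains (tuple u n)
          (tuple∈T≤ 1≤αq sharp (ℕ.≤-trans (ℕ.s≤s ℕ.z≤n) q≤n) q≤n nd≤R (proj₂ (proj₂ (spec i i≤))))

        position : Fin (length xs)
        position = index member

      -- Equal positions hold equal tuples, and the first component alone determines `n a`, hence
      -- `n`.
      position-injective : ∀ {j k} → position j ≡ position k → j ≡ k
      position-injective {j} {k} eq = Fin.toℕ-injective (ℕ.+-cancelˡ-≡ q _ _ (ν-injective _ _
        (ℕ.*-cancelʳ-≡ (n j) (n k) a (floor-injective u (1≤αq u (proj₁ sharp)) (q≤na j) (q≤na k) (cong proj₁ tuples≡)))))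
        where
        instance
          a≢0 : ℕ.NonZero a
          a≢0 = ℕ.>-nonZero 1≤a
        q≤na : ∀ j → q ℕ.≤ n j ℕ.* a
        q≤na j = ℕ.≤-trans (q≤n j) (ℕ.m≤m*n (n j) a)
        tuples≡ : tuple u (n j) ≡ tuple u (n k)
        tuples≡ = trans (lookup-index (member j)) (trans (cong (lookup xs) eq) (sym (lookup-index (member k))))

  dense-brick : ¬ ¬ Dense (d ℕ.* d)
  dense-brick = dense (d ℕ.* d) {{ℕ.m*n≢0 d d {{ℕ.>-nonZero 1≤d}} {{ℕ.>-nonZero 1≤d}}}} inhabited

-- Contradiction with few tuples

finite⇒no-brick : ∀ α 0<α → Finite (Tα α 0<α) → ¬ PerfectEulerBrick
finite⇒no-brick α 0<α (xs , complete) brick = dense-brick λ dense →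
  let E , at-least = count dense in
  ℕ.1+n≰n (at-least (suc (length xs)) xs λ t t∈T≤ →
    complete t (proj₁ (t∈T≤ (fromℕ (E ℕ.* suc (suc (length xs)))) λ { (q , n<q , q<n) → ℚ.<-asym n<q q<n })))
  where open Counting α 0<α (sort brick)

-- In the cut `c / x`, `s` bounds the ratio and `l < x`; a ratio below `1 / (K + 1)` thus becomes
-- `c (K + 1) < x`.
scaled-bound : ∀ c K s l → s ℚ.< value (1 /1+ K) → 0ℚ ℚ.< l → fromℕℚ c ℚ.≤ s ℚ.* l → fromℕℚ (c ℕ.* suc K) ℚ.< l
scaled-bound c K s l s<b 0<l c≤sl = begin-strict
  fromℕℚ (c ℕ.* suc K)                ≡⟨ value-scale (c /1+ 0) (suc K) ⟨
  fromℕℚ c ℚ.* fromℕℚ (suc K)         ≤⟨ *-mono-≤ʳ (0≤fromℕℚ (suc K)) c≤sl ⟩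
  s ℚ.* l ℚ.* fromℕℚ (suc K)          <⟨ *-mono-<ʳ (0<fromℕℚ-suc K) (*-mono-<ʳ 0<l s<b) ⟩
  b ℚ.* l ℚ.* fromℕℚ (suc K)          ≡⟨ cong (ℚ._* fromℕℚ (suc K)) (ℚ.*-comm b l) ⟩
  l ℚ.* b ℚ.* fromℕℚ (suc K)          ≡⟨ ℚ.*-assoc l b (fromℕℚ (suc K)) ⟩
  l ℚ.* (b ℚ.* fromℕℚ (suc K))        ≤⟨ *-mono-≤ˡ (ℚ.<⇒≤ 0<l) bK≤1 ⟩
  l ℚ.* 1ℚ                            ≡⟨ ℚ.*-identityʳ l ⟩
  l                                   ∎
  where
  open ℚ.≤-Reasoning
  b : ℚ
  b = value (1 /1+ K)
  bK≤1 : b ℚ.* fromℕℚ (suc K) ℚ.≤ 1ℚ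
  bK≤1 = subst (ℚ._≤ 1ℚ) (sym (value-scale (1 /1+ K) (suc K)))
    (value-mono-≤ ((1 ℕ.* suc K) /1+ K) (1 /1+ 0) (ℕ.≤-reflexive (ℕ.*-identityʳ (1 ℕ.* suc K))))

-- For `c ≥ 2` one has `c + 2 ≤ 2c`; for smaller `c` the lower bound `4(E + 1)` on `x` suffices.
within : ∀ x E c → fromℕ (suc E ℕ.* 4) ≤ x → fromℕ (c ℕ.* (2 ℕ.* suc E)) ≤ x → fromℕ (E ℕ.* suc (suc c)) ≤ x
within x E c 4E≤x 2cE≤x with ℕ.≤-total c 2
... | inj₁ c≤2 = fromℕ-≤-trans x (ℕ.*-mono-≤ (ℕ.n≤1+n E) (ℕ.s≤s (ℕ.s≤s c≤2))) 4E≤x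
... | inj₂ 2≤c = fromℕ-≤-trans x (begin
    E ℕ.* (2 ℕ.+ c)          ≤⟨ ℕ.*-mono-≤ (ℕ.n≤1+n E) (ℕ.+-monoˡ-≤ c 2≤c) ⟩
    suc E ℕ.* (c ℕ.+ c)      ≡⟨ double E c ⟩
    c ℕ.* (2 ℕ.* suc E)      ∎) 2cE≤x
  where
  open ℕ.≤-Reasoning
  double : ∀ E c → suc E ℕ.* (c ℕ.+ c) ≡ c ℕ.* (2 ℕ.* suc E)
  double = solve-∀

-- A ratio c/x below 1/2(E+1) at some x ≥ 4(E+1) gives E(c+2) ≤ x, where there are more than c tuples.
small-ratio : ∀ α 0<α E → LiminfAt∞ (T≤Ratio α 0<α) 0ℝ → ¬ (∀ N xs →
  (∀ t → (∀ x → fromℕ (E ℕ.* suc N) ≤ x → T≤ α 0<α x t) → t ∈ xs) → N ℕ.≤ length xs)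
small-ratio α 0<α E (_ , below) at-least = below (fromℚ (value (1 /1+ K))) 0<1/2E (fromℕ (suc E ℕ.* 4)) λ
  { (x , _ , 4E≤x , (_ , c , (xs , _ , complete , refl) , refl) , (_ , (s , s<p , l , Ll , 0<l , c≤sl) , p<b)) →
    ℕ.1+n≰n (at-least (suc c) xs λ t t∈T≤ → Equivalence.from (complete t) (t∈T≤ x (within x E c 4E≤x
      (L⇒≤ (c ℕ.* suc K) x (ℝ.L-lower x (scaled-bound c K s l (ℚ.<-trans s<p p<b) 0<l c≤sl) Ll))))) }
  where
  K : ℕ
  K = E ℕ.+ suc (E ℕ.+ 0) -- so that suc K is 2 ℕ.* suc E by definition

  0<1/2E : 0ℝ < fromℚ (value (1 /1+ K))
  0<1/2E = let m , 0<m , m<b = ℚ.<-dense (value-mono-< (0 /1+ 0) (1 /1+ K) (ℕ.s≤s ℕ.z≤n)) in m , 0<m , m<b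

liminf⇒no-brick : ∀ α 0<α → LiminfAt∞ (T≤Ratio α 0<α) 0ℝ → ¬ PerfectEulerBrick
liminf⇒no-brick α 0<α liminf brick = dense-brick λ dense →
  let E , at-least = count dense in small-ratio α 0<α E liminf at-least
  where open Counting α 0<α (sort brick)

theorem1p6 : ((Σ[ α ∈ ℝ ] Σ[ 0<α ∈ 0ℝ < α ] LiminfAt∞ (T≤Ratio α 0<α) 0ℝ) → ¬ PerfectEulerBrick)
    × ((Σ[ α ∈ ℝ ] Σ[ 0<α ∈ 0ℝ < α ] Finite (Tα α 0<α)) → ¬ PerfectEulerBrick)
theorem1p6 = (λ (α , 0<α , liminf) → liminf⇒no-brick α 0<α liminf)
           , (λ (α , 0<α , finite) → finite⇒no-brick α 0<α finite)
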